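{- Let $G$ be a connected nontrivial graph and $H$ a nontrivial graph. Consider the following two properties. $\mathcal{P}_1(G,H)$: $\delta(H)=0$ and $G$ is an efficient open domination graph. $\mathcal{P}_2(G,H)$: $\gamma(H)=1$ and $G$ is an efficient closed domination graph. The following statements hold. (i) If $\Delta(H)=|V(H)|-1$, then $\gamma_R^p(G\circ H)=2\gamma^p(G\circ H)$ if and only if $\mathcal{P}_2(G,H)$ holds. (ii) If $\Delta(H)=|V(H)|-2$, then the following statements hold. (a) If $\gamma_R^p(G\circ H)=2\gamma^p(G\circ H)$, then $\mathcal{P}_1(G,H)$ holds and $2\gamma_t(G)\le 2|S_1|+3|S_0|$ for every $S\in\wp_o(G)\cap\mathcal{D}(G)$. (b) If $\gamma_R^p(G)=2\gamma_t(G)$ or $\gamma_t(G)=\gamma(G)$, then $\gamma_R^p(G\circ H)=2\gamma^p(G\circ H)$ if and only if $\mathcal{P}_1(G,H)$ holds. (iii) If $\Delta(H)\le |V(H)|-3$, then $\gamma_R^p(G\circ H)=2\gamma^p(G\circ H)$ if and only if $\mathcal{P}_1(G,H)$ holds.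
   Context: All graphs are finite, simple and undirected; a graph is nontrivial if it has at least two vertices. $\delta(H)$ and $\Delta(H)$ are the minimum and maximum degrees of $H$. $N(v)$ is the open neighbourhood and $N[v]=N(v)\cup\{v\}$. $\mathcal{D}(G)$ is the set of dominating sets of $G$ (sets $S$ such that every vertex outside $S$ has at least one neighbour in $S$) and $\gamma(G)$ is the minimum size of one. $\gamma^p(G)$ is the minimum size of a perfect dominating set (every vertex outside $S$ has exactly one neighbour in $S$). For $G$ without isolated vertices, $\gamma_t(G)$ is the minimum size of a total dominating set (every vertex of $G$ has at least one neighbour in $S$). $\wp_o(G)$ is the set of open packings of $G$, i.e. sets $S\subseteq V(G)$ with $N(u)\cap N(v)=\varnothing$ for all distinct $u,v\in S$. For $S\in\wp_o(G)$, $S_0$ is the set of isolated vertices of the induced subgraph $G[S]$ and $S_1=S\setminus S_0$. $G$ is an efficient open domination graph if there is a set $D\subseteq V(G)$ with $V(G)=\bigcup_{u\in D}N(u)$ and $N(u)\cap N(v)=\varnothing$ for all distinct $u,v\in D$. $G$ is an efficient closed domination graph if there is a dominating set $S$ of $G$ with $N[u]\cap N[v]=\varnothing$ for all distinct $u,v\in S$. A perfect Roman dominating function (PRDF) on a graph $\Gamma$ is a function $f:V(\Gamma)\to\{0,1,2\}$ such that every vertex $u$ with $f(u)=0$ is adjacent to exactly one vertex $v$ with $f(v)=2$. Its weight is $\sum_v f(v)$, and $\gamma_R^p(\Gamma)$ is the minimum weight of a PRDF on $\Gamma$. The lexicographic product $G\circ H$ has vertex set $V(G)\times V(H)$, with $(u,v)$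 adjacent to $(x,y)$ iff $ux\in E(G)$, or $u=x$ and $vy\in E(H)$. -}

module Defs where

open import Data.Empty using (⊥-elim)
open import Data.Fin using (Fin; zero; suc; toℕ; remQuot; _≟_)
open import Data.Fin.Patterns using (0F; 1F; 2F)
open import Data.Fin.Properties using (any?; all?)
open import Data.Fin.Subset using (Subset; _∈_; _∉_; ∣_∣; _∩_; _∪_; _─_; ⁅_⁆; Empty; ⊤)
open import Data.Fin.Subset.Properties using (_∈?_; anySubset?; ∈⊤)
import Data.List as List
open import Data.List.Extrema.Nat using (min; max)
open import Data.Nat using (ℕ; zero; suc; _+_; _*_; _≤_; _<_; s≤s; z≤n)
import Data.Nat as ℕ
open import Data.Nat.Induction using (<-wellFounded)
open import Data.Nat.Properties using (≮⇒≥)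
open import Data.Product using (∃; ∃!; _×_; _,_; proj₁; proj₂)
open import Data.Sum using (_⊎_; inj₁; inj₂)
import Data.Sum as Sum
open import Data.Vec using (Vec; []; _∷_; lookup; tabulate; replicate; map; sum)
open import Data.Vec.Properties using (lookup-replicate)
open import Function using (_∘_)
open import Induction.WellFounded using (Acc; acc)
open import Level using (0ℓ)
open import Relation.Binary using (Rel; Symmetric)
import Relation.Binary as B
open import Relation.Binary.Construct.Closure.ReflexiveTransitive using (Star; ε; _◅_)
open import Relation.Binary.PropositionalEquality using (_≡_; _≢_; refl; sym; trans)
open import Relation.Nullary using (¬_; Dec; yes; no; does; ¬?; _×-dec_; _⊎-dec_; _→-dec_)
open import Relation.Nullary.Decidable using (map′)
open import Relation.Unary using (Pred; Decidable)

-- Finite simple graphs on the vertex set Fin n.  Adjacency is decidable, as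
-- for any explicitly given finite graph.

record Graph (n : ℕ) : Set₁ where
  field
    Adj    : Rel (Fin n) 0ℓ
    adj?   : B.Decidable Adj
    symm   : Symmetric Adj
    irrefl : ∀ {v} → ¬ Adj v v

open Graph public

private
  variable
    m n k : ℕ

Nontrivial : Graph n → Set
Nontrivial {n} _ = 2 ≤ n

Connected : Graph n → Set
Connected G = ∀ u v → Star (Adj G) u v

NoIsolated : Graph n → Set
NoIsolated G = ∀ u → ∃ λ v → Adj G u v

connected⇒noIsolated : (G : Graph n) → Connected G → Nontrivial G → NoIsolated G
connected⇒noIsolated G conn (s≤s (s≤s _)) u with other u
  where
  other : (u : Fin (suc (suc k))) → ∃ λ v → u ≢ v
  other zero    = suc zero , λ ()
  other (suc _) = zero , λ ()
... | v , u≢v with conn u v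
...   | ε     = ⊥-elim (u≢v refl)
...   | e ◅ _ = _ , e

N : Graph n → Fin n → Subset n
N G v = tabulate λ u → does (adj? G v u)

N[_] : Graph n → Fin n → Subset n
N[ G ] v = N G v ∪ ⁅ v ⁆

degree : Graph n → Fin n → ℕ
degree G v = ∣ N G v ∣

-- min and max also compare with their first argument; as 0 ≤ degree G v < n, it
-- does not affect the result unless n = 0.

δ : Graph n → ℕ
δ {n} G = min n (List.map (degree G) (List.allFin n))

Δ : Graph n → ℕ
Δ {n} G = max 0 (List.map (degree G) (List.allFin n))

-- The lexicographic product: remQuot identifies Fin (m * n) with Fin m × Fin n.

LexAdj : Graph m → Graph n → Rel (Fin m × Fin n) 0ℓ
LexAdj G H (u , v) (x , y) = Adj G u x ⊎ (u ≡ x × Adj H v y)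

infixl 7 _∘ₗ_

_∘ₗ_ : Graph m → Graph n → Graph (m * n)
_∘ₗ_ {m} {n} G H = record
  { Adj    = λ p q → LexAdj G H (remQuot {m} n p) (remQuot {m} n q)
  ; adj?   = λ p q → lex? (remQuot {m} n p) (remQuot {m} n q)
  ; symm   = λ {p} {q} → lexSym (remQuot {m} n p) (remQuot {m} n q)
  ; irrefl = λ {p} → lexIrrefl (remQuot {m} n p)
  }
  where
  lex? : B.Decidable (LexAdj G H)
  lex? (u , v) (x , y) = adj? G u x ⊎-dec ((u ≟ x) ×-dec adj? H v y)

  lexSym : ∀ p q → LexAdj G H p q → LexAdj G H q p
  lexSym _ _ = Sum.map (symm G) λ (e , a) → sym e , symm H a

  lexIrrefl : ∀ p → ¬ LexAdj G H p p
  lexIrrefl _ (inj₁ a)       = irrefl G a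
  lexIrrefl _ (inj₂ (_ , a)) = irrefl H a

IsMinimum : {A : Set} → Pred A 0ℓ → (A → ℕ) → ℕ → Set
IsMinimum P w k = (∃ λ a → P a × w a ≡ k) × (∀ a → P a → k ≤ w a)

Searchable : Set → Set₁
Searchable A = {Q : Pred A 0ℓ} → Decidable Q → Dec (∃ Q)

minimum : {A : Set} → Searchable A → {P : Pred A 0ℓ} → Decidable P →
          (w : A → ℕ) → ∃ P → ∃ (IsMinimum P w)
minimum {A} search {P} P? w (a , pa) = go a pa (<-wellFounded (w a))
  where
  go : ∀ a → P a → Acc _<_ (w a) → ∃ (IsMinimum P w)
  go a pa (acc rs) with search (λ b → P? b ×-dec (w b ℕ.<? w a))
  ... | yes (b , pb , b<a) = go b pb (rs b<a)
  ... | no  ∄b             =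
    w a , (a , pa , refl) , λ b pb → ≮⇒≥ λ b<a → ∄b (b , pb , b<a)

anyVec? : Searchable (Vec (Fin k) n)
anyVec? {n = zero}  Q? = map′ (λ q → [] , q) (λ { ([] , q) → q }) (Q? [])
anyVec? {n = suc _} Q? =
  map′ (λ (x , xs , q) → x ∷ xs , q) (λ { (x ∷ xs , q) → x , xs , q })
       (any? λ x → anyVec? λ xs → Q? (x ∷ xs))

any!? : {P : Pred (Fin n) 0ℓ} → Decidable P → Dec (∃! _≡_ P)
any!? P? = map′
  (λ (x , px , uniq) → x , px , λ {y} → uniq y)
  (λ (x , px , uniq) → x , px , λ y → uniq {y})
  (any? λ x → P? x ×-dec all? λ y → P? y →-dec (x ≟ y))

module _ (G : Graph n) where

  Dominating : Pred (Subset n) 0ℓ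
  Dominating S = ∀ u → u ∉ S → ∃ λ v → v ∈ S × Adj G u v

  PerfectDominating : Pred (Subset n) 0ℓ
  PerfectDominating S = ∀ u → u ∉ S → ∃! _≡_ λ v → v ∈ S × Adj G u v

  TotalDominating : Pred (Subset n) 0ℓ
  TotalDominating S = ∀ u → ∃ λ v → v ∈ S × Adj G u v

  -- The values 0, 1, 2 of f are the elements of Fin 3.
  PRDF : Pred (Vec (Fin 3) n) 0ℓ
  PRDF f = ∀ u → lookup f u ≡ 0F → ∃! _≡_ λ v → lookup f v ≡ 2F × Adj G u v

  weight : Vec (Fin 3) n → ℕ
  weight f = sum (map toℕ f)

  dominating? : Decidable Dominating
  dominating? S = all? λ u → ¬? (u ∈? S) →-dec
                  any? λ v → (v ∈? S) ×-dec adj? G u v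

  perfectDominating? : Decidable PerfectDominating
  perfectDominating? S = all? λ u → ¬? (u ∈? S) →-dec
                         any!? λ v → (v ∈? S) ×-dec adj? G u v

  totalDominating? : Decidable TotalDominating
  totalDominating? S = all? λ u → any? λ v → (v ∈? S) ×-dec adj? G u v

  prdf? : Decidable PRDF
  prdf? f = all? λ u → (lookup f u ≟ 0F) →-dec
            any!? λ v → (lookup f v ≟ 2F) ×-dec adj? G u v

  ⊤-dominating : Dominating ⊤
  ⊤-dominating u u∉⊤ = ⊥-elim (u∉⊤ ∈⊤)

  ⊤-perfectDominating : PerfectDominating ⊤
  ⊤-perfectDominating u u∉⊤ = ⊥-elim (u∉⊤ ∈⊤)

  ⊤-totalDominating : NoIsolated G → TotalDominating ⊤
  ⊤-totalDominating noIso u = proj₁ (noIso u) , ∈⊤ , proj₂ (noIso u)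

  constant-1-PRDF : PRDF (replicate n 1F)
  constant-1-PRDF u f[u]≡0 with () ← trans (sym (lookup-replicate u 1F)) f[u]≡0

  γ : ℕ
  γ = proj₁ (minimum anySubset? dominating? ∣_∣ (⊤ , ⊤-dominating))

  γᵖ : ℕ
  γᵖ = proj₁ (minimum anySubset? perfectDominating? ∣_∣ (⊤ , ⊤-perfectDominating))

  γₜ : NoIsolated G → ℕ
  γₜ noIso = proj₁ (minimum anySubset? totalDominating? ∣_∣ (⊤ , ⊤-totalDominating noIso))

  γᵖᴿ : ℕ
  γᵖᴿ = proj₁ (minimum anyVec? prdf? weight (replicate n 1F , constant-1-PRDF))

  OpenPacking : Pred (Subset n) 0ℓ
  OpenPacking S = ∀ u v → u ∈ S → v ∈ S → u ≢ v → Empty (N G u ∩ N G v)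

  -- For S a set of vertices, S₀ = isolatedPart S consists of the isolated vertices
  -- of the induced subgraph G[S], and S₁ = nonIsolatedPart S.

  isolatedIn? : ∀ S → Decidable (λ v → v ∈ S × (∀ u → u ∈ S → ¬ Adj G v u))
  isolatedIn? S v = (v ∈? S) ×-dec all? λ u → (u ∈? S) →-dec ¬? (adj? G v u)

  isolatedPart : Subset n → Subset n
  isolatedPart S = tabulate λ v → does (isolatedIn? S v)

  nonIsolatedPart : Subset n → Subset n
  nonIsolatedPart S = S ─ isolatedPart S

  EfficientOpenDomination : Set
  EfficientOpenDomination = ∃ λ D → (∀ v → ∃ λ u → u ∈ D × v ∈ N G u) × OpenPacking D

  EfficientClosedDomination : Set
  EfficientClosedDomination = ∃ λ S → Dominating S ×
    (∀ u v → u ∈ S → v ∈ S → u ≢ v → Empty (N[ G ] u ∩ N[ G ] v))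

P₁ : Graph m → Graph n → Set
P₁ G H = δ H ≡ 0 × EfficientOpenDomination G

P₂ : Graph m → Graph n → Set
P₂ G H = γ H ≡ 1 × EfficientClosedDomination G

{-# OPTIONS --safe #-}
module Submission where

-- Let S be a perfect dominating set of G ∘ H other than the whole vertex set.  No fibre
-- {u} × H lies in S, since fullness would spread along the edges of G; so any two vertices
-- of S lying in fibres adjacent to u coincide.  Hence the projection of S to G is an
-- efficient open dominating set if H has no universal vertex (and then the vertices
-- of S sit over isolated vertices of H), and an efficient closed one otherwise.  If
-- γᵖᴿ = 2 γᵖ, a minimum S is proper, as the constant function 1 is a PRDF.
--
-- Conversely, an efficient set D of G times an isolated or universal vertex of H is perfect
-- dominating, so γᵖ (G ∘ H) ≤ ∣ D ∣, which is at most γₜ G or γ G.  It then suffices to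
-- bound the weight of every PRDF of G ∘ H below by 2 γ G, by γᵖᴿ G and, if Δ H ≤ n − 3,
-- by 2 γₜ G; in each case a suitable object on G is read off from the fibres.

open import Defs
open import Data.Bool using (Bool; true; false; if_then_else_)
open import Data.Empty using (⊥-elim)
open import Data.Fin using (Fin; zero; suc; toℕ; combine; remQuot; _↑ˡ_; _↑ʳ_; _≟_)
open import Data.Fin.Patterns using (0F; 1F; 2F)
open import Data.Fin.Properties
  using (any?; all?; ¬∀⟶∃¬; suc-injective; combine-remQuot; remQuot-combine)
open import Data.Fin.Subset
  using (Subset; inside; outside; _∈_; _∉_; ∣_∣; _⊆_; _∪_; _∩_; _-_; Empty; ⁅_⁆; ⊤; ⊥)
open import Data.Fin.Subset.Properties
  using (_∈?_; anySubset?; ∈⊤; ∣⊤∣≡n; ∣⊥∣≡0; p⊆q⇒∣p∣≤∣q∣; x∈p⇒∣p-x∣<∣p∣; x∈p∧x≢y⇒x∈p-y;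
         x∈⁅x⁆; x∈⁅y⁆⇒x≡y; ∣⁅x⁆∣≡1; x∈p∪q⁺; x∈p∪q⁻; x∈p∩q⁺; x∈p∩q⁻; x∈p∧x∉q⇒x∈p─q)
import Data.List as List
open import Data.List.Extrema.Nat using (min≤xs; xs≤max; argmax-sel; argmin-sel)
open import Data.List.Membership.Propositional.Properties using (∈-map⁻; ∈-map⁺; ∈-allFin)
import Data.List.Relation.Unary.All as All
open import Data.Nat using (ℕ; zero; suc; _+_; _*_; _≤_; _<_; z≤n; s≤s)
open import Data.Nat.Properties hiding (_≟_; suc-injective)
open import Data.Product using (∃; ∃!; _×_; _,_; proj₁; proj₂; uncurry)
open import Data.Sum using (_⊎_; inj₁; inj₂)
import Data.Vec
open import Data.Vec using (Vec; []; _∷_; lookup; tabulate; replicate; map; here; there)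
open import Data.Vec.Properties using (lookup∘tabulate; lookup-map; lookup⇒[]=; []=⇒lookup)
open import Function using (_∘_; id)
open import Function.Bundles using (_⇔_; mk⇔)
open import Level using (0ℓ)
open import Relation.Binary.Construct.Closure.ReflexiveTransitive using (Star; ε; _◅_)
open import Relation.Binary.PropositionalEquality
open import Relation.Nullary
  using (¬_; Dec; yes; no; does; ¬?; _×-dec_; _⊎-dec_; _→-dec_; contradiction)
open import Relation.Nullary.Decidable using (dec-true; decidable-stable)
open import Relation.Unary using (Pred; Decidable)
open import Algebra.Properties.CommutativeMonoid.Sum +-0-commutativeMonoid
  using (sum; ∑-distrib-+; sum-cong-≗)
open import Algebra.Properties.Semiring.Sum +-*-semiring using (*-distribˡ-sum)

private
  variable
    m n : ℕ

-- Subsets of Fin n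

⟦_⟧ : {P : Pred (Fin n) 0ℓ} → Decidable P → Subset n
⟦ P? ⟧ = tabulate λ x → does (P? x)

∈⟦⟧⁺ : {P : Pred (Fin n) 0ℓ} (P? : Decidable P) {x : Fin n} → P x → x ∈ ⟦ P? ⟧
∈⟦⟧⁺ P? {x} px = lookup⇒[]= x _ (trans (lookup∘tabulate _ x) (dec-true (P? x) px))

∈⟦⟧⁻ : {P : Pred (Fin n) 0ℓ} (P? : Decidable P) {x : Fin n} → x ∈ ⟦ P? ⟧ → P x
∈⟦⟧⁻ P? {x} x∈ with P? x | trans (sym (lookup∘tabulate (does ∘ P?) x)) ([]=⇒lookup x∈)
... | yes px | _  = px
... | no _   | ()

∈⇒0<∣∣ : {p : Subset n} {x : Fin n} → x ∈ p → 1 ≤ ∣ p ∣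
∈⇒0<∣∣ x∈p = ≤-trans (s≤s z≤n) (x∈p⇒∣p-x∣<∣p∣ x∈p)

two-∈⇒2≤∣∣ : {p : Subset n} {x y : Fin n} → x ∈ p → y ∈ p → y ≢ x → 2 ≤ ∣ p ∣
two-∈⇒2≤∣∣ x∈p y∈p y≢x =
  ≤-trans (s≤s (∈⇒0<∣∣ (x∈p∧x≢y⇒x∈p-y y∈p y≢x))) (x∈p⇒∣p-x∣<∣p∣ x∈p)

∉⇒⊆- : {p q : Subset n} {x : Fin n} → p ⊆ q → x ∉ p → p ⊆ q - x
∉⇒⊆- p⊆q x∉p y∈p = x∈p∧x≢y⇒x∈p-y (p⊆q y∈p) λ { refl → x∉p y∈p }

∣⊤-v∣<n : (v : Fin n) → ∣ ⊤ - v ∣ < n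
∣⊤-v∣<n {n} v = subst (∣ ⊤ - v ∣ <_) (∣⊤∣≡n n) (x∈p⇒∣p-x∣<∣p∣ (∈⊤ {x = v}))

∣∪∣≤ : (p q : Subset n) → ∣ p ∪ q ∣ ≤ ∣ p ∣ + ∣ q ∣
∣∪∣≤ []            []            = z≤n
∣∪∣≤ (outside ∷ p) (outside ∷ q) = ∣∪∣≤ p q
∣∪∣≤ (outside ∷ p) (inside ∷ q)  =
  ≤-trans (s≤s (∣∪∣≤ p q)) (≤-reflexive (sym (+-suc ∣ p ∣ ∣ q ∣)))
∣∪∣≤ (inside ∷ p)  (outside ∷ q) = s≤s (∣∪∣≤ p q)
∣∪∣≤ (inside ∷ p)  (inside ∷ q)  =
  s≤s (≤-trans (∣∪∣≤ p q) (+-monoʳ-≤ ∣ p ∣ (n≤1+n ∣ q ∣)))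

-- A relation instead of a function lets the chosen `y` depend on the proof of membership. The
-- induction deletes from `q` the partner of each element of `p`; injectivity keeps the remaining
-- partners.
∣∣-injection : (R : Fin m → Fin n → Set) (p : Subset m) (q : Subset n) →
  (∀ {x} → x ∈ p → ∃ λ y → y ∈ q × R x y) →
  (∀ {x x′ y} → R x y → R x′ y → x ≡ x′) → ∣ p ∣ ≤ ∣ q ∣
∣∣-injection R []            q f inj = z≤n
∣∣-injection R (outside ∷ p) q f inj =
  ∣∣-injection (R ∘ suc) p q (f ∘ there) λ r r′ → suc-injective (inj r r′)
∣∣-injection R (inside ∷ p)  q f inj with f here
... | y , y∈q , r = ≤-trans (s≤s (∣∣-injection (R ∘ suc) p (q - y) f′ inj′)) (x∈p⇒∣p-x∣<∣p∣ y∈q)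
  where
  f′ : ∀ {x} → x ∈ p → ∃ λ y′ → y′ ∈ q - y × R (suc x) y′
  f′ x∈p with f (there x∈p)
  ... | y′ , y′∈q , r′ = y′ , x∈p∧x≢y⇒x∈p-y y′∈q (λ { refl → contradiction (inj r r′) λ () }) , r′

  inj′ : ∀ {x x′ z} → R (suc x) z → R (suc x′) z → x ≡ x′
  inj′ s s′ = suc-injective (inj s s′)

two-elements : 2 ≤ n → ∃ λ (a : Fin n) → ∃ λ b → a ≢ b
two-elements (s≤s (s≤s _)) = 0F , 1F , λ ()

other-element : 2 ≤ n → (a : Fin n) → ∃ λ b → a ≢ b
other-element 2≤n a with two-elements 2≤n
... | b , c , b≢c with a ≟ b
...   | yes refl = c , b≢c
...   | no  a≢b  = b , a≢b

-- Finite sums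

sum-mono : {g h : Fin n → ℕ} → (∀ i → g i ≤ h i) → sum g ≤ sum h
sum-mono {zero}  g≤h = z≤n
sum-mono {suc n} g≤h = +-mono-≤ (g≤h zero) (sum-mono (g≤h ∘ suc))

term≤sum : (g : Fin n → ℕ) (i : Fin n) → g i ≤ sum g
term≤sum g zero    = m≤m+n _ _
term≤sum g (suc i) = ≤-trans (term≤sum (g ∘ suc) i) (m≤n+m _ (g zero))

sum-++ : (g : Fin (m + n) → ℕ) → sum g ≡ sum (λ i → g (i ↑ˡ n)) + sum (λ j → g (m ↑ʳ j))
sum-++ {zero}  g = refl
sum-++ {suc m} g = trans (cong (g zero +_) (sum-++ {m} (g ∘ suc))) (sym (+-assoc (g zero) _ _))

sum-combine : (g : Fin (m * n) → ℕ) → sum g ≡ sum λ (i : Fin m) → sum λ (j : Fin n) → g (combine i j)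
sum-combine {zero}      g = refl
sum-combine {suc m} {n} g =
  trans (sum-++ {n} g) (cong (sum (λ j → g (j ↑ˡ (m * n))) +_) (sum-combine {m} λ p → g (n ↑ʳ p)))

χ : Subset n → Fin n → ℕ
χ p i = if lookup p i then 1 else 0

χ-∈ : {p : Subset n} {i : Fin n} → i ∈ p → χ p i ≡ 1
χ-∈ i∈p = cong (if_then 1 else 0) ([]=⇒lookup i∈p)

χ≤1 : (p : Subset n) (i : Fin n) → χ p i ≤ 1
χ≤1 p i with lookup p i
... | true  = s≤s z≤n
... | false = z≤n

χ-∉ : (p : Subset n) {i : Fin n} → i ∉ p → χ p i ≡ 0
χ-∉ p {i} i∉p with lookup p i in eq
... | true  = contradiction (lookup⇒[]= i p eq) i∉p
... | false = refl

∣∣≡sum-χ : (p : Subset n) → ∣ p ∣ ≡ sum (χ p)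
∣∣≡sum-χ []            = refl
∣∣≡sum-χ (inside ∷ p)  = cong suc (∣∣≡sum-χ p)
∣∣≡sum-χ (outside ∷ p) = ∣∣≡sum-χ p

sum-χ : (a : ℕ) (p : Subset n) → sum (λ i → a * χ p i) ≡ a * ∣ p ∣
sum-χ a p = trans (sym (*-distribˡ-sum a (χ p))) (cong (a *_) (sym (∣∣≡sum-χ p)))

sum-χ₂ : (a b : ℕ) (p q : Subset n) →
  sum (λ i → a * χ p i + b * χ q i) ≡ a * ∣ p ∣ + b * ∣ q ∣
sum-χ₂ a b p q = trans (∑-distrib-+ (λ i → a * χ p i) (λ i → b * χ q i))
  (cong₂ _+_ (sum-χ a p) (sum-χ b q))

*∣∣≤sum : (c : ℕ) (p : Subset n) {w : Fin n → ℕ} → (∀ i → i ∈ p → c ≤ w i) → c * ∣ p ∣ ≤ sum w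
*∣∣≤sum c p {w} c≤w = ≤-trans (≤-reflexive (sym (sum-χ c p))) (sum-mono bound)
  where
  bound : ∀ i → c * χ p i ≤ w i
  bound i with i ∈? p
  ... | yes i∈p rewrite χ-∈ i∈p = ≤-trans (≤-reflexive (*-identityʳ c)) (c≤w i i∈p)
  ... | no  i∉p rewrite χ-∉ p i∉p | *-zeroʳ c = z≤n

-- Degrees

Isolated : Graph n → Fin n → Set
Isolated G v = ∀ u → ¬ Adj G v u

Universal : Graph n → Fin n → Set
Universal G v = ∀ u → v ≢ u → Adj G v u

∈N⁺ : (G : Graph n) {u v : Fin n} → Adj G v u → u ∈ N G v
∈N⁺ G {v = v} = ∈⟦⟧⁺ (adj? G v)

∈N⁻ : (G : Graph n) {u v : Fin n} → u ∈ N G v → Adj G v u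
∈N⁻ G {v = v} = ∈⟦⟧⁻ (adj? G v)

-- A non-neighbour `u` other than `v` would confine the neighbourhood to a set of at most n - 2
-- vertices.
degree≡n∸1⇒universal : (H : Graph n) (v : Fin n) → degree H v + 1 ≡ n → Universal H v
degree≡n∸1⇒universal {n} H v deg u v≢u with adj? H v u
... | yes a = a
... | no ¬a = ⊥-elim (<-irrefl refl too-many)
  where
  N⊆ : N H v ⊆ (⊤ - v) - u
  N⊆ = ∉⇒⊆- (∉⇒⊆- (λ _ → ∈⊤) (irrefl H ∘ ∈N⁻ H)) (¬a ∘ ∈N⁻ H)

  open ≤-Reasoning
  too-many : suc n ≤ n
  too-many = begin
    suc n                       ≡⟨ cong suc (sym deg) ⟩
    suc (degree H v + 1)        ≡⟨ cong suc (+-comm (degree H v) 1) ⟩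
    2 + degree H v              ≤⟨ s≤s (s≤s (p⊆q⇒∣p∣≤∣q∣ N⊆)) ⟩
    2 + ∣ (⊤ - v) - u ∣         ≤⟨ s≤s (x∈p⇒∣p-x∣<∣p∣ (x∈p∧x≢y⇒x∈p-y ∈⊤ (≢-sym v≢u))) ⟩
    1 + ∣ ⊤ - v ∣               ≤⟨ ∣⊤-v∣<n v ⟩
    n                           ∎

-- The vertex `v₁` already misses itself and the isolated `v₀`; a third miss would force its degree
-- down to n - 3.
degree≡n∸2⇒adj : (H : Graph n) {v₀ v₁ : Fin n} → Isolated H v₀ → v₀ ≢ v₁ → degree H v₁ + 2 ≡ n →
  ∀ v → v ≢ v₀ → v ≢ v₁ → Adj H v₁ v
degree≡n∸2⇒adj {n} H {v₀} {v₁} iso v₀≢v₁ deg v v≢v₀ v≢v₁ with adj? H v₁ v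
... | yes a = a
... | no ¬a = ⊥-elim (<-irrefl refl too-many)
  where
  N⊆ : N H v₁ ⊆ ((⊤ - v₁) - v₀) - v
  N⊆ = ∉⇒⊆- (∉⇒⊆- (∉⇒⊆- (λ _ → ∈⊤) (irrefl H ∘ ∈N⁻ H)) (iso v₁ ∘ symm H ∘ ∈N⁻ H)) (¬a ∘ ∈N⁻ H)

  open ≤-Reasoning
  too-many : suc n ≤ n
  too-many = begin
    suc n                       ≡⟨ cong suc (sym deg) ⟩
    suc (degree H v₁ + 2)       ≡⟨ cong suc (+-comm (degree H v₁) 2) ⟩
    3 + degree H v₁             ≤⟨ s≤s (s≤s (s≤s (p⊆q⇒∣p∣≤∣q∣ N⊆))) ⟩
    3 + ∣ ((⊤ - v₁) - v₀) - v ∣ ≤⟨ s≤s (s≤s (x∈p⇒∣p-x∣<∣p∣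
                                     (x∈p∧x≢y⇒x∈p-y (x∈p∧x≢y⇒x∈p-y ∈⊤ v≢v₁) v≢v₀))) ⟩
    2 + ∣ (⊤ - v₁) - v₀ ∣       ≤⟨ s≤s (x∈p⇒∣p-x∣<∣p∣ (x∈p∧x≢y⇒x∈p-y ∈⊤ v₀≢v₁)) ⟩
    1 + ∣ ⊤ - v₁ ∣              ≤⟨ ∣⊤-v∣<n v₁ ⟩
    n                           ∎

cover⇒n≤∣∣+∣∣ : (p q : Subset n) → (∀ x → x ∈ p ⊎ x ∈ q) → n ≤ ∣ p ∣ + ∣ q ∣
cover⇒n≤∣∣+∣∣ {n} p q cover = begin
  n             ≡⟨ ∣⊤∣≡n n ⟨
  ∣ ⊤ {n} ∣     ≤⟨ p⊆q⇒∣p∣≤∣q∣ {p = ⊤} (λ {x} _ → x∈p∪q⁺ (cover x)) ⟩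
  ∣ p ∪ q ∣     ≤⟨ ∣∪∣≤ p q ⟩
  ∣ p ∣ + ∣ q ∣ ∎
  where open ≤-Reasoning

universal⇒n≤degree+1 : (H : Graph n) {v : Fin n} → Universal H v → n ≤ degree H v + 1
universal⇒n≤degree+1 {n} H {v} univ =
  subst (λ k → n ≤ degree H v + k) (∣⁅x⁆∣≡1 v) (cover⇒n≤∣∣+∣∣ (N H v) ⁅ v ⁆ cover)
  where
  cover : ∀ u → u ∈ N H v ⊎ u ∈ ⁅ v ⁆
  cover u with v ≟ u
  ... | yes refl = inj₂ (x∈⁅x⁆ v)
  ... | no  v≢u  = inj₁ (∈N⁺ H (univ u v≢u))

degree≡0⇒isolated : (H : Graph n) {v : Fin n} → degree H v ≡ 0 → Isolated H v
degree≡0⇒isolated H deg u a = contradiction (subst (1 ≤_) deg (∈⇒0<∣∣ (∈N⁺ H a))) λ ()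

isolated⇒degree≡0 : (H : Graph n) {v : Fin n} → Isolated H v → degree H v ≡ 0
isolated⇒degree≡0 {n} H {v} iso = n≤0⇒n≡0 (subst (degree H v ≤_) (∣⊥∣≡0 n)
  (p⊆q⇒∣p∣≤∣q∣ {q = ⊥} λ u∈N → ⊥-elim (iso _ (∈N⁻ H u∈N))))

degree<n : (H : Graph n) (v : Fin n) → degree H v < n
degree<n {n} H v = begin-strict
  degree H v  ≤⟨ p⊆q⇒∣p∣≤∣q∣ (∉⇒⊆- (λ _ → ∈⊤) (irrefl H ∘ ∈N⁻ H)) ⟩
  ∣ ⊤ - v ∣   <⟨ ∣⊤-v∣<n v ⟩
  n           ∎
  where open ≤-Reasoning

degree≤Δ : (H : Graph n) (v : Fin n) → degree H v ≤ Δ H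
degree≤Δ {n} H v = All.lookup (xs≤max 0 _) (∈-map⁺ (degree H) (∈-allFin v))

δ≤degree : (H : Graph n) (v : Fin n) → δ H ≤ degree H v
δ≤degree {n} H v = All.lookup (min≤xs n _) (∈-map⁺ (degree H) (∈-allFin v))

Δ-attained : (H : Graph n) → Fin n → ∃ λ v → degree H v ≡ Δ H
Δ-attained {n} H v₀ with argmax-sel id 0 (List.map (degree H) (List.allFin n))
-- If the maximum is the default 0, every degree is 0 and any vertex attains it.
... | inj₁ Δ≡0 = v₀ , trans (n≤0⇒n≡0 (subst (degree H v₀ ≤_) Δ≡0 (degree≤Δ H v₀))) (sym Δ≡0)
... | inj₂ Δ∈ with ∈-map⁻ (degree H) Δ∈
...   | v , _ , Δ≡ = v , sym Δ≡

δ-attained : (H : Graph n) → Fin n → ∃ λ v → degree H v ≡ δ H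
δ-attained {n} H v₀ with argmin-sel id n (List.map (degree H) (List.allFin n))
-- The default n exceeds every degree, so it cannot be the minimum once a vertex exists.
... | inj₁ δ≡n =
  contradiction (subst (_≤ degree H v₀) δ≡n (δ≤degree H v₀)) (<⇒≱ (degree<n H v₀))
... | inj₂ δ∈ with ∈-map⁻ (degree H) δ∈
...   | v , _ , δ≡ = v , sym δ≡

δ≡0⇒isolated : (H : Graph n) → Fin n → δ H ≡ 0 → ∃ (Isolated H)
δ≡0⇒isolated H v₀ δ≡0 with δ-attained H v₀
... | v , deg = v , degree≡0⇒isolated H (trans deg δ≡0)

isolated⇒δ≡0 : (H : Graph n) {v : Fin n} → Isolated H v → δ H ≡ 0
isolated⇒δ≡0 H {v} iso = n≤0⇒n≡0 (subst (δ H ≤_) (isolated⇒degree≡0 H iso) (δ≤degree H v))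

-- Domination numbers

γ-minimum : (G : Graph n) → IsMinimum (Dominating G) ∣_∣ (γ G)
γ-minimum G = proj₂ (minimum anySubset? (dominating? G) ∣_∣ (⊤ , ⊤-dominating G))

γᵖ-minimum : (G : Graph n) → IsMinimum (PerfectDominating G) ∣_∣ (γᵖ G)
γᵖ-minimum G = proj₂ (minimum anySubset? (perfectDominating? G) ∣_∣ (⊤ , ⊤-perfectDominating G))

γₜ-minimum : (G : Graph n) (noIso : NoIsolated G) → IsMinimum (TotalDominating G) ∣_∣ (γₜ G noIso)
γₜ-minimum G noIso =
  proj₂ (minimum anySubset? (totalDominating? G) ∣_∣ (⊤ , ⊤-totalDominating G noIso))

γᵖᴿ-minimum : (G : Graph n) → IsMinimum (PRDF G) (weight G) (γᵖᴿ G)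
γᵖᴿ-minimum {n} G =
  proj₂ (minimum anyVec? (prdf? G) (weight G) (replicate n 1F , constant-1-PRDF G))

universal⇒γ≡1 : (H : Graph n) {v : Fin n} → Universal H v → γ H ≡ 1
universal⇒γ≡1 H {v} univ with γ-minimum H
... | (S , dom , ∣S∣≡γ) , least = ≤-antisym γ≤1 (subst (1 ≤_) ∣S∣≡γ 1≤∣S∣)
  where
  γ≤1 : γ H ≤ 1
  γ≤1 = subst (γ H ≤_) (∣⁅x⁆∣≡1 v) (least ⁅ v ⁆ λ u u∉ →
    v , x∈⁅x⁆ v , symm H (univ u λ { refl → u∉ (x∈⁅x⁆ v) }))

  1≤∣S∣ : 1 ≤ ∣ S ∣
  1≤∣S∣ with v ∈? S
  ... | yes v∈S = ∈⇒0<∣∣ v∈S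
  ... | no  v∉S = ∈⇒0<∣∣ (proj₁ (proj₂ (dom v v∉S)))

openPacking-unique : (G : Graph n) {D : Subset n} → OpenPacking G D →
  ∀ {s t u} → s ∈ D → t ∈ D → Adj G u s → Adj G u t → s ≡ t
openPacking-unique G packing {s} {t} s∈D t∈D us ut = decidable-stable (s ≟ t) λ s≢t →
  packing s t s∈D t∈D s≢t (_ , x∈p∩q⁺ (∈N⁺ G (symm G us) , ∈N⁺ G (symm G ut)))

-- Each element of `D` has a neighbour in a minimum total dominating set, and no two elements of an
-- open packing share one.
openPacking≤γₜ : (G : Graph n) (noIso : NoIsolated G) {D : Subset n} →
  OpenPacking G D → ∣ D ∣ ≤ γₜ G noIso
openPacking≤γₜ G noIso {D} packing with γₜ-minimum G noIso
... | (T , total , ∣T∣≡γₜ) , _ = subst (∣ D ∣ ≤_) ∣T∣≡γₜ (∣∣-injection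
  (λ s t → s ∈ D × Adj G s t) D T
  (λ {s} s∈D → let t , t∈T , st = total s in t , t∈T , s∈D , st)
  (λ (s∈D , st) (s′∈D , s′t) → openPacking-unique G packing s∈D s′∈D (symm G st) (symm G s′t)))

∈N[]⁺ : (G : Graph n) {u v : Fin n} → Adj G v u ⊎ u ≡ v → u ∈ N[ G ] v
∈N[]⁺ G (inj₁ a)    = x∈p∪q⁺ (inj₁ (∈N⁺ G a))
∈N[]⁺ G (inj₂ refl) = x∈p∪q⁺ (inj₂ (x∈⁅x⁆ _))

∈N[]⁻ : (G : Graph n) {u v : Fin n} → u ∈ N[ G ] v → Adj G v u ⊎ u ≡ v
∈N[]⁻ G {v = v} u∈ with x∈p∪q⁻ (N G v) ⁅ v ⁆ u∈
... | inj₁ u∈N = inj₁ (∈N⁻ G u∈N)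
... | inj₂ u∈v = inj₂ (x∈⁅y⁆⇒x≡y v u∈v)

ClosedPacking : Graph n → Pred (Subset n) 0ℓ
ClosedPacking G S = ∀ u v → u ∈ S → v ∈ S → u ≢ v → Empty (N[ G ] u ∩ N[ G ] v)

closedPacking-unique : (G : Graph n) {S : Subset n} → ClosedPacking G S →
  ∀ {s t u} → s ∈ S → t ∈ S → Adj G s u ⊎ u ≡ s → Adj G t u ⊎ u ≡ t → s ≡ t
closedPacking-unique G packing {s} {t} s∈S t∈S su tu = decidable-stable (s ≟ t) λ s≢t →
  packing s t s∈S t∈S s≢t (_ , x∈p∩q⁺ (∈N[]⁺ G su , ∈N[]⁺ G tu))

-- The same counting with closed neighbourhoods: an element of `S` that lies in the dominating set
-- is its own partner.
closedPacking≤γ : (G : Graph n) {S : Subset n} → ClosedPacking G S → ∣ S ∣ ≤ γ G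
closedPacking≤γ G {S} packing with γ-minimum G
... | (T , dom , ∣T∣≡γ) , _ = subst (∣ S ∣ ≤_) ∣T∣≡γ (∣∣-injection
  (λ s t → s ∈ S × (Adj G s t ⊎ t ≡ s)) S T
  dominator (λ (s∈S , st) (s′∈S , s′t) → closedPacking-unique G packing s∈S s′∈S st s′t))
  where
  dominator : ∀ {s} → s ∈ S → ∃ λ t → t ∈ T × s ∈ S × (Adj G s t ⊎ t ≡ s)
  dominator {s} s∈S with s ∈? T
  ... | yes s∈T = s , s∈T , s∈S , inj₂ refl
  ... | no  s∉T = let t , t∈T , st = dom s s∉T in t , t∈T , s∈S , inj₁ st

-- Weights of perfect Roman dominating functions

∑-weight : (G : Graph n) (f : Vec (Fin 3) n) → weight G f ≡ sum λ i → toℕ (lookup f i)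
∑-weight {n} _ = go
  where
  go : ∀ {k} (f : Vec (Fin 3) k) → Data.Vec.sum (map toℕ f) ≡ sum λ i → toℕ (lookup f i)
  go []      = refl
  go (x ∷ f) = cong (toℕ x +_) (go f)

constant-1-weight : (G : Graph n) → weight G (replicate n 1F) ≡ n
constant-1-weight {n} _ = go n
  where
  go : ∀ k → Data.Vec.sum (map toℕ (replicate {A = Fin 3} k 1F)) ≡ k
  go zero    = refl
  go (suc k) = cong suc (go k)

γᵖᴿ≤n : (G : Graph n) → γᵖᴿ G ≤ n
γᵖᴿ≤n {n} G = subst (γᵖᴿ G ≤_) (constant-1-weight G)
  (proj₂ (γᵖᴿ-minimum G) (replicate n 1F) (constant-1-PRDF G))

-- Twice the indicator function of a perfect dominating set is a PRDF.
γᵖᴿ≤2γᵖ : (G : Graph n) → γᵖᴿ G ≤ 2 * γᵖ G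
γᵖᴿ≤2γᵖ {n} G with γᵖ-minimum G
... | (S , pd , ∣S∣≡γᵖ) , _ = begin
  γᵖᴿ G                         ≤⟨ proj₂ (γᵖᴿ-minimum G) (map twice S) prdf ⟩
  weight G (map twice S)        ≡⟨ weight-twice S ⟩
  2 * ∣ S ∣                     ≡⟨ cong (2 *_) ∣S∣≡γᵖ ⟩
  2 * γᵖ G                      ∎
  where
  open ≤-Reasoning

  twice : Bool → Fin 3
  twice b = if b then 2F else 0F

  ∈⇒2 : ∀ {v} → v ∈ S → lookup (map twice S) v ≡ 2F
  ∈⇒2 {v} v∈S = trans (lookup-map v twice S) (cong twice ([]=⇒lookup v∈S))

  2⇒∈ : ∀ {v} → lookup (map twice S) v ≡ 2F → v ∈ S
  2⇒∈ {v} eq with lookup S v in S[v] | trans (sym (lookup-map v twice S)) eq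
  ... | true  | _ = lookup⇒[]= v S S[v]
  ... | false | ()

  prdf : PRDF G (map twice S)
  prdf u eq with pd u (λ u∈S → contradiction (trans (sym (∈⇒2 u∈S)) eq) λ ())
  ... | v , (v∈S , a) , unique = v , (∈⇒2 v∈S , a) , λ (eq′ , a′) → unique (2⇒∈ eq′ , a′)

  weight-twice : ∀ {k} (T : Subset k) → Data.Vec.sum (map toℕ (map twice T)) ≡ 2 * ∣ T ∣
  weight-twice []            = refl
  weight-twice (outside ∷ T) = weight-twice T
  weight-twice (inside ∷ T)  = trans (cong (2 +_) (weight-twice T)) (sym (*-suc 2 ∣ T ∣))

-- The first decision takes precedence, so the conditions for 2 and for 1 may overlap.
label : {A B : Set} → Dec A → Dec B → Fin 3
label (yes _) _       = 2F
label (no _)  (yes _) = 1F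
label (no _)  (no _)  = 0F

label≡2 : {A B : Set} (a? : Dec A) (b? : Dec B) → label a? b? ≡ 2F → A
label≡2 (yes a) _       _  = a
label≡2 (no _)  (yes _) ()
label≡2 (no _)  (no _)  ()

2≡label : {A B : Set} (a? : Dec A) (b? : Dec B) → A → label a? b? ≡ 2F
2≡label (yes _) _ _ = refl
2≡label (no ¬a) _ a = ⊥-elim (¬a a)

label≡0 : {A B : Set} (a? : Dec A) (b? : Dec B) → label a? b? ≡ 0F → ¬ A × ¬ B
label≡0 (yes _) _       ()
label≡0 (no _)  (yes _) ()
label≡0 (no ¬a) (no ¬b) _  = ¬a , ¬b

label≤ : {A B : Set} {k : ℕ} (a? : Dec A) (b? : Dec B) → 
  (A → 2 ≤ k) → (B → 1 ≤ k) → toℕ (label a? b?) ≤ k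
label≤ (yes a) _       2≤k _   = 2≤k a
label≤ (no _)  (yes b) _   1≤k = 1≤k b
label≤ (no _)  (no _)  _   _   = z≤n

-- Neighbours in the lexicographic product

module _ (G : Graph m) (H : Graph n) where

  -- Moves unique neighbours from encoded vertices to pairs, where an adjacency splits into one
  -- between fibres and one inside a fibre.
  ∃!-fibre⁻ : {P : Pred (Fin (m * n)) 0ℓ} (u : Fin m) (v : Fin n) →
    (∃! _≡_ λ q → P q × Adj (G ∘ₗ H) (combine u v) q) →
    ∃! _≡_ λ xy → P (uncurry combine xy) × LexAdj G H (u , v) xy
  ∃!-fibre⁻ {P} u v (q , (pq , a) , unique) =
    remQuot n q ,
    (subst P (sym (combine-remQuot {m} n q)) pq ,
     subst (λ p → LexAdj G H p (remQuot n q)) (remQuot-combine u v) a) ,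
    λ {xy} (p′ , a′) → trans
      (cong (remQuot n) (unique (p′ , subst₂ (LexAdj G H) (sym (remQuot-combine u v))
                                        (sym (remQuot-combine (proj₁ xy) (proj₂ xy))) a′)))
      (remQuot-combine (proj₁ xy) (proj₂ xy))

  ∃!-fibre⁺ : {Q : Pred (Fin m × Fin n) 0ℓ} {P : Pred (Fin (m * n)) 0ℓ} →
    (∀ {q} → P q → Q (remQuot n q)) → (∀ {q} → Q (remQuot n q) → P q) → (p : Fin (m * n)) →
    (∃! _≡_ λ xy → Q xy × LexAdj G H (remQuot n p) xy) →
    ∃! _≡_ λ q → P q × Adj (G ∘ₗ H) p q
  ∃!-fibre⁺ {Q} P⇒Q Q⇒P p ((x , y) , (qxy , a) , unique) =
    combine x y ,
    (Q⇒P (subst Q (sym (remQuot-combine x y)) qxy) ,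
     subst (LexAdj G H (remQuot n p)) (sym (remQuot-combine x y)) a) ,
    λ {q} (pq , a′) → trans (cong (uncurry combine) (unique (P⇒Q pq , a′))) (combine-remQuot {m} n q)

  -- Perfect dominating sets of the form D × {v}

  layer : Subset m → Fin n → Subset (m * n)
  layer D v = ⟦ (λ p → (proj₁ (remQuot {m} n p) ∈? D) ×-dec (proj₂ (remQuot {m} n p) ≟ v)) ⟧

  module _ (D : Subset m) (v₀ : Fin n) where

    private
      InD : Pred (Fin m × Fin n) 0ℓ
      InD (x , y) = x ∈ D × y ≡ v₀

      ∈layer⁺ : ∀ {q} → InD (remQuot n q) → q ∈ layer D v₀
      ∈layer⁺ = ∈⟦⟧⁺ (λ p → (proj₁ (remQuot {m} n p) ∈? D) ×-dec (proj₂ (remQuot {m} n p) ≟ v₀))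

      ∈layer⁻ : ∀ {q} → q ∈ layer D v₀ → InD (remQuot n q)
      ∈layer⁻ = ∈⟦⟧⁻ (λ p → (proj₁ (remQuot {m} n p) ∈? D) ×-dec (proj₂ (remQuot {m} n p) ≟ v₀))

    ∣layer∣≤ : ∣ layer D v₀ ∣ ≤ ∣ D ∣
    ∣layer∣≤ = ∣∣-injection (λ q x → InD (remQuot n q) × proj₁ (remQuot {m} n q) ≡ x) (layer D v₀) D
      (λ q∈ → _ , proj₁ (∈layer⁻ q∈) , ∈layer⁻ q∈ , refl)
      (λ {q} {q′} ((_ , e) , x) ((_ , e′) , x′) → trans (sym (combine-remQuot {m} n q)) (trans
        (cong₂ combine (trans x (sym x′)) (trans e (sym e′))) (combine-remQuot {m} n q′)))

    γᵖ≤∣layer∣ : (∀ u v → ¬ InD (u , v) → ∃! _≡_ λ xy → InD xy × LexAdj G H (u , v) xy) →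
      γᵖ (G ∘ₗ H) ≤ ∣ D ∣
    γᵖ≤∣layer∣ pd = ≤-trans (proj₂ (γᵖ-minimum (G ∘ₗ H)) (layer D v₀) λ p p∉ →
      ∃!-fibre⁺ ∈layer⁻ ∈layer⁺ p (pd _ _ (p∉ ∘ ∈layer⁺))) ∣layer∣≤

  -- Take D × {v₀} with `v₀` isolated in `H`. Every vertex of `G` has exactly one neighbour in `D`,
  -- and `v₀` creates no adjacency inside a fibre.
  P₁⇒γᵖ≤γₜ : (noIso : NoIsolated G) → Fin n → P₁ G H → γᵖ (G ∘ₗ H) ≤ γₜ G noIso
  P₁⇒γᵖ≤γₜ noIso v (δ≡0 , D , cover , packing) with δ≡0⇒isolated H v δ≡0
  ... | v₀ , iso = ≤-trans (γᵖ≤∣layer∣ D v₀ pd) (openPacking≤γₜ G noIso packing)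
    where
    pd : ∀ u v → ¬ (u ∈ D × v ≡ v₀) →
      ∃! _≡_ λ ((x , y) : Fin m × Fin n) → (x ∈ D × y ≡ v₀) × LexAdj G H (u , v) (x , y)
    pd u v _ with cover u
    ... | x , x∈D , u∈N = (x , v₀) , ((x∈D , refl) , inj₁ (symm G (∈N⁻ G u∈N))) , unique
      where
      unique : ∀ {xy} → (proj₁ xy ∈ D × proj₂ xy ≡ v₀) × LexAdj G H (u , v) xy → (x , v₀) ≡ xy
      unique ((x′∈D , refl) , inj₁ a) =
        cong (_, v₀) (openPacking-unique G packing x∈D x′∈D (symm G (∈N⁻ G u∈N)) a)
      unique ((_ , refl) , inj₂ (_ , a)) = ⊥-elim (iso v (symm H a))

  -- In D × {v₀}, a vertex over `D` is dominated inside its own fibre only, since `D` is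
  -- independent; any other vertex is dominated through the unique neighbour in `D` of its
  -- projection.
  efficientClosed⇒γᵖ≤γ : {v₀ : Fin n} → Universal H v₀ → EfficientClosedDomination G →
    γᵖ (G ∘ₗ H) ≤ γ G
  efficientClosed⇒γᵖ≤γ {v₀} univ (D , dom , packing) =
    ≤-trans (γᵖ≤∣layer∣ D v₀ pd) (closedPacking≤γ G packing)
    where
    pd : ∀ u v → ¬ (u ∈ D × v ≡ v₀) →
      ∃! _≡_ λ ((x , y) : Fin m × Fin n) → (x ∈ D × y ≡ v₀) × LexAdj G H (u , v) (x , y)
    pd u v ∉D with u ∈? D
    ... | yes u∈D = (u , v₀) , ((u∈D , refl) , inj₂ (refl , vv₀)) , unique
      where
      vv₀ : Adj H v v₀
      vv₀ = symm H (univ v λ { refl → ∉D (u∈D , refl) })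

      unique : ∀ {xy} → (proj₁ xy ∈ D × proj₂ xy ≡ v₀) × LexAdj G H (u , v) xy → (u , v₀) ≡ xy
      unique ((x′∈D , refl) , inj₁ a) =
        cong (_, v₀) (closedPacking-unique G packing u∈D x′∈D (inj₂ refl) (inj₁ (symm G a)))
      unique ((_ , refl) , inj₂ (refl , _)) = refl
    ... | no u∉D with dom u u∉D
    ...   | x , x∈D , a = (x , v₀) , ((x∈D , refl) , inj₁ a) , unique
      where
      unique : ∀ {xy} → (proj₁ xy ∈ D × proj₂ xy ≡ v₀) × LexAdj G H (u , v) xy → (x , v₀) ≡ xy
      unique ((x′∈D , refl) , inj₁ a′) =
        cong (_, v₀) (closedPacking-unique G packing x∈D x′∈D (inj₁ (symm G a)) (inj₁ (symm G a′)))
      unique ((u∈D , _) , inj₂ (refl , _)) = ⊥-elim (u∉D u∈D)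

-- Structure of the perfect dominating sets of the lexicographic product

module _ (G : Graph m) (H : Graph n) {S : Subset (m * n)}
         (pd : PerfectDominating (G ∘ₗ H) S) where

  neighbour : ∀ {u v} → combine u v ∉ S →
    ∃ λ x → ∃ λ y → combine x y ∈ S × LexAdj G H (u , v) (x , y)
  neighbour ∉S with ∃!-fibre⁻ G H {_∈ S} _ _ (pd _ ∉S)
  ... | (x , y) , (∈S , a) , _ = x , y , ∈S , a

  neighbour-unique : ∀ {u v x y x′ y′} → combine u v ∉ S → combine x y ∈ S → combine x′ y′ ∈ S →
    LexAdj G H (u , v) (x , y) → LexAdj G H (u , v) (x′ , y′) → (x , y) ≡ (x′ , y′)
  neighbour-unique ∉S ∈S ∈S′ a a′ with ∃!-fibre⁻ G H {_∈ S} _ _ (pd _ ∉S)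
  ... | _ , _ , unique = trans (sym (unique (∈S , a))) (unique (∈S′ , a′))

  full-fibres : 2 ≤ n → ∀ {u x} → Star (Adj G) u x →
    (∀ v → combine u v ∈ S) → ∀ v → combine x v ∈ S
  full-fibres 2≤n ε full = full
  full-fibres 2≤n {u} (_◅_ {j = x} a as) full = full-fibres 2≤n as λ v →
    -- A missing vertex would be adjacent to the whole full fibre, hence to two elements of `S`.
    decidable-stable (combine x v ∈? S) λ ∉S →
      let b , c , b≢c = two-elements 2≤n
      in b≢c (cong proj₂ (neighbour-unique ∉S (full b) (full c)
                            (inj₁ (symm G a)) (inj₁ (symm G a))))

  module _ (noIso : NoIsolated G) (gap : ∀ (u : Fin m) → ∃ λ (v : Fin n) → combine u v ∉ S) where

    -- The gap in the fibre of `u` is adjacent to everything over the neighbours of `u`, yet has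
    -- only one neighbour in `S`.
    adjacent-unique : ∀ {u x y x′ y′} → Adj G u x → Adj G u x′ →
      combine x y ∈ S → combine x′ y′ ∈ S → (x , y) ≡ (x′ , y′)
    adjacent-unique {u} a a′ ∈S ∈S′ with gap u
    ... | _ , ∉S = neighbour-unique ∉S ∈S ∈S′ (inj₁ a) (inj₁ a′)

    private
      inProjection? : Decidable λ (x : Fin m) → ∃ λ (v : Fin n) → combine x v ∈ S
      inProjection? x = any? λ v → combine x v ∈? S

    projection : Subset m
    projection = ⟦ inProjection? ⟧

    ∣projection∣≤ : ∣ projection ∣ ≤ ∣ S ∣
    ∣projection∣≤ = ∣∣-injection (λ x q → proj₁ (remQuot {m} n q) ≡ x) projection S
      (λ {x} x∈ → let v , ∈S = ∈⟦⟧⁻ inProjection? x∈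
                  in combine x v , ∈S , cong proj₁ (remQuot-combine x v))
      (λ e e′ → trans (sym e) e′)

    -- If no fibre next to u met S, then the fibre of u would meet S in a single vertex,
    -- which would have to be universal in H.
    projection-total : (∀ v → ¬ Universal H v) → TotalDominating G projection
    projection-total noUniversal u with any? (λ x → (x ∈? projection) ×-dec adj? G u x)
    ... | yes dominated = dominated
    ... | no  isolated with gap u
    ...   | w , ∉S with neighbour ∉S
    ...     | x , y , ∈S , inj₁ a = ⊥-elim (isolated (x , ∈⟦⟧⁺ inProjection? (y , ∈S) , a))
    ...     | _ , a , ∈S , inj₂ (refl , _) = ⊥-elim (noUniversal a universal)
      where
      only : ∀ {b} → combine u b ∈ S → a ≡ b
      only ∈S′ with noIso u
      ... | x , ux = cong proj₂ (adjacent-unique (symm G ux) (symm G ux) ∈S ∈S′)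

      universal : Universal H a
      universal b a≢b with neighbour (a≢b ∘ only)
      ... | x , y , ∈S′ , inj₁ ux = ⊥-elim (isolated (x , ∈⟦⟧⁺ inProjection? (y , ∈S′) , ux))
      ... | _ , y , ∈S′ , inj₂ (refl , by) = symm H (subst (Adj H b) (sym (only ∈S′)) by)

    projection-openPacking : OpenPacking G projection
    projection-openPacking u v u∈ v∈ u≢v (x , x∈) =
      let x∈N[u] , x∈N[v] = x∈p∩q⁻ (N G u) (N G v) x∈
          _ , ∈S = ∈⟦⟧⁻ inProjection? u∈
          _ , ∈S′ = ∈⟦⟧⁻ inProjection? v∈
      in u≢v (cong proj₁ (adjacent-unique (symm G (∈N⁻ G x∈N[u])) (symm G (∈N⁻ G x∈N[v])) ∈S ∈S′))

    -- Totality gives adjacent `x` and `y` in the projection, and `S` meets the fibre of `x` only in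
    -- (x, v). A neighbour of `v` in `H` would thus give a vertex outside `S` adjacent to both (x,
    -- v) and (y, w).
    isolated-vertex : TotalDominating G projection → Fin m → ∃ (Isolated H)
    isolated-vertex total u with total u
    ... | x , x∈ , ux with ∈⟦⟧⁻ inProjection? x∈ | total x
    ...   | v , ∈S | y , y∈ , xy with ∈⟦⟧⁻ inProjection? y∈
    ...     | w , ∈S′ = v , isolated
      where
      isolated : Isolated H v
      isolated v′ a with combine x v′ ∈? S
      ... | yes ∈S″ = irrefl H (subst (Adj H v) (sym (cong proj₂ (adjacent-unique ux ux ∈S ∈S″))) a)
      ... | no  ∉S with refl ← neighbour-unique ∉S ∈S ∈S′ (inj₂ (refl , symm H a)) (inj₁ xy) =
        irrefl G xy

    projection⇒P₁ : (∀ v → ¬ Universal H v) → Fin m → P₁ G H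
    projection⇒P₁ noUniversal u =
      isolated⇒δ≡0 H (proj₂ (isolated-vertex total u)) ,
      projection ,
      (λ v → let x , x∈ , a = total v in x , x∈ , ∈N⁺ G (symm G a)) ,
      projection-openPacking
      where
      total : TotalDominating G projection
      total = projection-total noUniversal

    γₜ≤∣S∣ : (∀ v → ¬ Universal H v) → γₜ G noIso ≤ ∣ S ∣
    γₜ≤∣S∣ noUniversal =
      ≤-trans (proj₂ (γₜ-minimum G noIso) projection (projection-total noUniversal)) ∣projection∣≤

    projection-dominating : Fin n → Dominating G projection
    projection-dominating v₀ u u∉ with neighbour (λ ∈S → u∉ (∈⟦⟧⁺ inProjection? (v₀ , ∈S)))
    ... | x , y , ∈S , inj₁ a          = x , ∈⟦⟧⁺ inProjection? (y , ∈S) , a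
    ... | _ , y , ∈S , inj₂ (refl , _) = ⊥-elim (u∉ (∈⟦⟧⁺ inProjection? (y , ∈S)))

    -- For adjacent `u` and `x`, some vertex over `u` outside `S` would be dominated both from its
    -- own fibre and from that of `x`: it is (u, v₀) if this is not in `S`, and the gap over `u`
    -- otherwise.
    projection-independent : ∀ {v₀} → Universal H v₀ → ∀ {u x} →
      u ∈ projection → x ∈ projection → ¬ Adj G u x
    projection-independent {v₀} univ {u} u∈ x∈ ux with ∈⟦⟧⁻ inProjection? u∈ | ∈⟦⟧⁻ inProjection? x∈
    ... | a , ∈S | b , ∈S′ with combine u v₀ ∈? S
    ...   | no ∉S with refl ← neighbour-unique ∉S ∈S ∈S′
                                (inj₂ (refl , univ a λ { refl → ∉S ∈S })) (inj₁ ux) = irrefl G ux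
    ...   | yes ∈S₀ with gap u
    ...     | w , ∉S with refl ← neighbour-unique ∉S ∈S₀ ∈S′
                                  (inj₂ (refl , symm H (univ w λ { refl → ∉S ∈S₀ }))) (inj₁ ux) =
      irrefl G ux

    projection-closedPacking : ∀ {v₀} → Universal H v₀ → ClosedPacking G projection
    projection-closedPacking univ u v u∈ v∈ u≢v (x , x∈)
      with x∈p∩q⁻ (N[ G ] u) (N[ G ] v) x∈
    ... | x∈N[u] , x∈N[v] with ∈N[]⁻ G x∈N[u] | ∈N[]⁻ G x∈N[v]
    ...   | inj₁ ux   | inj₁ vx   = u≢v (cong proj₁ (adjacent-unique (symm G ux) (symm G vx)
                                     (proj₂ (∈⟦⟧⁻ inProjection? u∈)) (proj₂ (∈⟦⟧⁻ inProjection? v∈))))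
    ...   | inj₁ ux   | inj₂ refl = projection-independent univ u∈ v∈ ux
    ...   | inj₂ refl | inj₁ vx   = projection-independent univ v∈ u∈ vx
    ...   | inj₂ refl | inj₂ refl = u≢v refl

    projection⇒efficientClosed : ∀ {v₀} → Universal H v₀ → EfficientClosedDomination G
    projection⇒efficientClosed {v₀} univ =
      projection , projection-dominating v₀ , projection-closedPacking univ

-- A full perfect dominating set is too heavy, since the constant function 1 is a PRDF.
equality⇒gap : (G : Graph m) (H : Graph n) → Connected G → 2 ≤ n → γᵖᴿ (G ∘ₗ H) ≡ 2 * γᵖ (G ∘ₗ H) →
  ∀ {S} → PerfectDominating (G ∘ₗ H) S → ∣ S ∣ ≡ γᵖ (G ∘ₗ H) → ∀ u → ∃ λ v → combine u v ∉ S
equality⇒gap {m} {n} G H conn 2≤n eq {S} pd ∣S∣≡γᵖ u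
  with all? (λ v → combine u v ∈? S)
... | no  ¬full = ¬∀⟶∃¬ n (λ v → combine u v ∈ S) (λ v → combine u v ∈? S) ¬full
... | yes full  = ⊥-elim (<-irrefl refl ∣S∣<∣S∣)
  where
  open ≤-Reasoning

  -- Connectedness carries fullness from the fibre of `u` to all fibres.
  ⊤⊆S : ⊤ ⊆ S
  ⊤⊆S {p} _ = subst (_∈ S) (combine-remQuot {m} n p)
    (full-fibres G H pd 2≤n (conn u _) full (proj₂ (remQuot {m} n p)))

  1≤∣S∣ : 1 ≤ ∣ S ∣
  1≤∣S∣ = ∈⇒0<∣∣ (full (proj₁ (two-elements 2≤n)))

  ∣S∣<∣S∣ : ∣ S ∣ < ∣ S ∣
  ∣S∣<∣S∣ = begin-strict
    ∣ S ∣             <⟨ m<m+n ∣ S ∣ (≤-trans 1≤∣S∣ (m≤m+n ∣ S ∣ 0)) ⟩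
    2 * ∣ S ∣         ≡⟨ cong (2 *_) ∣S∣≡γᵖ ⟩
    2 * γᵖ (G ∘ₗ H)   ≡⟨ eq ⟨
    γᵖᴿ (G ∘ₗ H)      ≤⟨ γᵖᴿ≤n (G ∘ₗ H) ⟩
    m * n             ≡⟨ ∣⊤∣≡n (m * n) ⟨
    ∣ ⊤ {m * n} ∣     ≤⟨ p⊆q⇒∣p∣≤∣q∣ ⊤⊆S ⟩
    ∣ S ∣             ∎

-- Lower bounds for the weight of a PRDF on the lexicographic product

toℕ≥1 : {i : Fin 3} → i ≢ 0F → 1 ≤ toℕ i
toℕ≥1 {0F} i≢0 = ⊥-elim (i≢0 refl)
toℕ≥1 {1F} _   = s≤s z≤n
toℕ≥1 {2F} _   = s≤s z≤n

noZero⇒n≤sum : (h : Fin n → Fin 3) → (∀ v → h v ≢ 0F) → n ≤ sum (toℕ ∘ h)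
noZero⇒n≤sum {n} h noZero = begin
  n               ≡⟨ ∣⊤∣≡n n ⟨
  ∣ ⊤ {n} ∣       ≡⟨ *-identityˡ _ ⟨
  1 * ∣ ⊤ {n} ∣   ≤⟨ *∣∣≤sum 1 ⊤ (λ v _ → toℕ≥1 (noZero v)) ⟩
  sum (toℕ ∘ h)   ∎
  where open ≤-Reasoning

two⇒2≤sum : (h : Fin n → Fin 3) {v : Fin n} → h v ≡ 2F → 2 ≤ sum (toℕ ∘ h)
two⇒2≤sum h {v} hv≡2 = subst (λ i → toℕ i ≤ sum (toℕ ∘ h)) hv≡2 (term≤sum (toℕ ∘ h) v)

-- A single vertex of value 2 leaves at least two further vertices which are not 0.
prdf-row-weight : (H : Graph n) → Δ H + 3 ≤ n → (h : Fin n → Fin 3) →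
  (∀ v → h v ≡ 0F → ∃ λ w → h w ≡ 2F × Adj H v w) → ∀ {v} → h v ≡ 2F → 4 ≤ sum (toℕ ∘ h)
prdf-row-weight {n} H Δ+3≤n h dom {v} hv≡2 = ≤-trans 4≤∣P∣+∣Q∣ ∣P∣+∣Q∣≤sum
  where
  P? : Decidable λ w → h w ≢ 0F
  P? w = ¬? (h w ≟ 0F)
  Q? : Decidable λ w → h w ≡ 2F
  Q? w = h w ≟ 2F

  P Q : Subset n
  P = ⟦ P? ⟧
  Q = ⟦ Q? ⟧

  Q⊆P : Q ⊆ P
  Q⊆P w∈Q = ∈⟦⟧⁺ P? λ hw≡0 → contradiction (trans (sym hw≡0) (∈⟦⟧⁻ Q? w∈Q)) λ ()

  v∈Q : v ∈ Q
  v∈Q = ∈⟦⟧⁺ Q? hv≡2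

  -- A value 1 counts once, through `P`; a value 2 counts twice, through `P` and `Q`.
  pointwise : ∀ w → 1 * χ P w + 1 * χ Q w ≤ toℕ (h w)
  pointwise w with h w in eq
  ... | 0F rewrite χ-∉ P {w} (λ w∈P → ∈⟦⟧⁻ P? w∈P eq)
                 | χ-∉ Q {w} (λ w∈Q → contradiction (trans (sym eq) (∈⟦⟧⁻ Q? w∈Q)) λ ()) = z≤n
  ... | 1F rewrite χ-∉ Q {w} (λ w∈Q → contradiction (trans (sym eq) (∈⟦⟧⁻ Q? w∈Q)) λ ()) =
    +-mono-≤ (*-monoʳ-≤ 1 (χ≤1 P w)) z≤n
  ... | 2F = +-mono-≤ (*-monoʳ-≤ 1 (χ≤1 P w)) (*-monoʳ-≤ 1 (χ≤1 Q w))

  ∣P∣+∣Q∣≤sum : ∣ P ∣ + ∣ Q ∣ ≤ sum (toℕ ∘ h)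
  ∣P∣+∣Q∣≤sum = begin
    ∣ P ∣ + ∣ Q ∣                       ≡⟨ cong₂ _+_ (*-identityˡ ∣ P ∣) (*-identityˡ ∣ Q ∣) ⟨
    1 * ∣ P ∣ + 1 * ∣ Q ∣               ≡⟨ sum-χ₂ 1 1 P Q ⟨
    sum (λ w → 1 * χ P w + 1 * χ Q w)   ≤⟨ sum-mono pointwise ⟩
    sum (toℕ ∘ h)                       ∎
    where open ≤-Reasoning

  4≤∣P∣+∣Q∣ : 4 ≤ ∣ P ∣ + ∣ Q ∣
  4≤∣P∣+∣Q∣ with any? (λ w → Q? w ×-dec ¬? (w ≟ v))
  ... | yes (w , hw≡2 , w≢v) = +-mono-≤ (≤-trans 2≤∣Q∣ (p⊆q⇒∣p∣≤∣q∣ Q⊆P)) 2≤∣Q∣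
    where
    2≤∣Q∣ : 2 ≤ ∣ Q ∣
    2≤∣Q∣ = two-∈⇒2≤∣∣ v∈Q (∈⟦⟧⁺ Q? hw≡2) w≢v
  -- Now `v` carries the only 2, so every 0 is a neighbour of `v` and at least n - Δ H ≥ 3 vertices
  -- are nonzero.
  ... | no only = +-mono-≤ 3≤∣P∣ (∈⇒0<∣∣ v∈Q)
    where
    cover : ∀ w → w ∈ N H v ⊎ w ∈ P
    cover w with h w ≟ 0F
    ... | no  hw≢0 = inj₂ (∈⟦⟧⁺ P? hw≢0)
    ... | yes hw≡0 with dom w hw≡0
    ...   | x , hx≡2 , wx =
      inj₁ (∈N⁺ H (symm H (subst (Adj H w) x≡v wx)))
      where
      x≡v : x ≡ v
      x≡v = decidable-stable (x ≟ v) λ x≢v → only (x , hx≡2 , x≢v)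

    3≤∣P∣ : 3 ≤ ∣ P ∣
    3≤∣P∣ = +-cancelˡ-≤ (degree H v) 3 ∣ P ∣ (begin
      degree H v + 3       ≤⟨ +-monoˡ-≤ 3 (degree≤Δ H v) ⟩
      Δ H + 3              ≤⟨ Δ+3≤n ⟩
      n                    ≤⟨ cover⇒n≤∣∣+∣∣ (N H v) P cover ⟩
      degree H v + ∣ P ∣   ∎)
      where open ≤-Reasoning

module _ (G : Graph m) (H : Graph n) (2≤n : 2 ≤ n) 
         (f : Vec (Fin 3) (m * n)) (prdf : PRDF (G ∘ₗ H) f) where

  private
    F : Fin m → Fin n → Fin 3
    F u v = lookup f (combine u v)

    row : Fin m → ℕ
    row u = sum (toℕ ∘ F u)

    HasTwo : Pred (Fin m) 0ℓ
    HasTwo u = ∃ λ v → F u v ≡ 2F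

    hasTwo? : Decidable HasTwo
    hasTwo? u = any? λ v → F u v ≟ 2F

    NoZero : Pred (Fin m) 0ℓ
    NoZero u = ∀ v → F u v ≢ 0F

    noZero? : Decidable NoZero
    noZero? u = all? λ v → ¬? (F u v ≟ 0F)

    ¬noZero⇒zero : ∀ {u} → ¬ NoZero u → ∃ λ v → F u v ≡ 0F
    ¬noZero⇒zero {u} ¬noZero with any? (λ v → F u v ≟ 0F)
    ... | yes ∃0 = ∃0
    ... | no  ∄    = ⊥-elim (¬noZero λ v Fuv≡0 → ∄ (v , Fuv≡0))

    defended : ∀ {u v} → F u v ≡ 0F →
      ∃! _≡_ λ ((x , y) : Fin m × Fin n) → F x y ≡ 2F × LexAdj G H (u , v) (x , y)
    defended {u} {v} Fuv≡0 = ∃!-fibre⁻ G H {λ q → lookup f q ≡ 2F} u v (prdf _ Fuv≡0)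

    noZero⇒2≤row : ∀ {u} → NoZero u → 2 ≤ row u
    noZero⇒2≤row {u} noZero = ≤-trans 2≤n (noZero⇒n≤sum (F u) noZero)

    weight≡∑row : weight (G ∘ₗ H) f ≡ sum row
    weight≡∑row = trans (∑-weight (G ∘ₗ H) f) (sum-combine {m} {n} (toℕ ∘ lookup f))

  -- The fibres containing a 2 or no 0 form a dominating set of G.
  2γ≤weight : 2 * γ G ≤ weight (G ∘ₗ H) f
  2γ≤weight = begin
    2 * γ G              ≤⟨ *-monoʳ-≤ 2 (proj₂ (γ-minimum G) T dominating) ⟩
    2 * ∣ T ∣            ≤⟨ *∣∣≤sum 2 T (λ u u∈T → heavy (∈⟦⟧⁻ T? u∈T)) ⟩
    sum row              ≡⟨ weight≡∑row ⟨
    weight (G ∘ₗ H) f    ∎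
    where
    open ≤-Reasoning

    T? : Decidable λ u → HasTwo u ⊎ NoZero u
    T? u = hasTwo? u ⊎-dec noZero? u

    T : Subset m
    T = ⟦ T? ⟧

    heavy : ∀ {u} → HasTwo u ⊎ NoZero u → 2 ≤ row u
    heavy {u} (inj₁ (v , Fuv≡2)) = two⇒2≤sum (F u) Fuv≡2
    heavy (inj₂ noZero)          = noZero⇒2≤row noZero

    -- A fibre outside `T` has a 0 but no 2, so the 2 defending that 0 lies in an adjacent fibre.
    dominating : Dominating G T
    dominating u u∉T with ¬noZero⇒zero (λ noZero → u∉T (∈⟦⟧⁺ T? (inj₂ noZero)))
    ... | v , Fuv≡0 with defended Fuv≡0
    ...   | (x , y) , (Fxy≡2 , inj₁ a) , _          = x , ∈⟦⟧⁺ T? (inj₁ (y , Fxy≡2)) , a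
    ...   | (_ , y) , (Fuy≡2 , inj₂ (refl , _)) , _ = ⊥-elim (u∉T (∈⟦⟧⁺ T? (inj₁ (y , Fuy≡2))))

  -- Give each vertex of `G` the largest value in its fibre. Over a vertex of value 0 the fibre is
  -- entirely 0, and uniqueness of its defender leaves exactly one adjacent fibre containing a 2.
  γᵖᴿ≤weight : γᵖᴿ G ≤ weight (G ∘ₗ H) f
  γᵖᴿ≤weight = begin
    γᵖᴿ G                             ≤⟨ proj₂ (γᵖᴿ-minimum G) g prdf-g ⟩
    weight G g                        ≡⟨ ∑-weight G g ⟩
    sum (λ u → toℕ (lookup g u))      ≤⟨ sum-mono value≤row ⟩
    sum row                           ≡⟨ weight≡∑row ⟨
    weight (G ∘ₗ H) f                 ∎
    where
    open ≤-Reasoning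

    nonzero? : Decidable λ u → ∃ λ v → F u v ≢ 0F
    nonzero? u = any? λ v → ¬? (F u v ≟ 0F)

    g : Vec (Fin 3) m
    g = tabulate λ u → label (hasTwo? u) (nonzero? u)

    value≤row : ∀ u → toℕ (lookup g u) ≤ row u
    value≤row u = ≤-trans (≤-reflexive (cong toℕ (lookup∘tabulate _ u)))
      (label≤ (hasTwo? u) (nonzero? u) (λ (_ , Fuv≡2) → two⇒2≤sum (F u) Fuv≡2)
        (λ (v , Fuv≢0) → ≤-trans (toℕ≥1 Fuv≢0) (term≤sum (toℕ ∘ F u) v)))

    zeros : ∀ u → lookup g u ≡ 0F → ∀ v → F u v ≡ 0F
    zeros u gu≡0 v = decidable-stable (F u v ≟ 0F) λ Fuv≢0 → proj₂
      (label≡0 (hasTwo? u) (nonzero? u) (trans (sym (lookup∘tabulate _ u)) gu≡0)) (v , Fuv≢0)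

    g≡2⇒hasTwo : ∀ {x} → lookup g x ≡ 2F → HasTwo x
    g≡2⇒hasTwo {x} eq = label≡2 (hasTwo? x) (nonzero? x) (trans (sym (lookup∘tabulate _ x)) eq)

    prdf-g : PRDF G g
    prdf-g u gu≡0 with defended (zeros u gu≡0 (proj₁ (two-elements 2≤n)))
    ... | (x , y) , (Fxy≡2 , inj₁ a) , unique =
      x , (trans (lookup∘tabulate _ x) (2≡label (hasTwo? x) (nonzero? x) (y , Fxy≡2)) , a) ,
      λ (gx′≡2 , a′) → cong proj₁ (unique (proj₂ (g≡2⇒hasTwo gx′≡2) , inj₁ a′))
    ... | (_ , y) , (Fuy≡2 , inj₂ (refl , _)) , _ = 
      contradiction (trans (sym (zeros u gu≡0 y)) Fuy≡2) λ ()

  -- The fibres containing a 2, together with one neighbour of each vertex that has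
  -- no neighbour among them, form a total dominating set of G.
  2γₜ≤weight : (noIso : NoIsolated G) → Δ H + 3 ≤ n → 2 * γₜ G noIso ≤ weight (G ∘ₗ H) f
  2γₜ≤weight noIso Δ+3≤n = begin
    2 * γₜ G noIso                      ≤⟨ *-monoʳ-≤ 2 (proj₂ (γₜ-minimum G noIso) (T ∪ I) total) ⟩
    2 * ∣ T ∪ I ∣                       ≤⟨ *-monoʳ-≤ 2 (≤-trans (∣∪∣≤ T I) (+-monoʳ-≤ ∣ T ∣ ∣I∣≤∣B∣)) ⟩
    2 * (∣ T ∣ + ∣ B ∣)                 ≡⟨ *-distribˡ-+ 2 ∣ T ∣ ∣ B ∣ ⟩
    2 * ∣ T ∣ + 2 * ∣ B ∣               ≡⟨ sum-χ₂ 2 2 T B ⟨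
    sum (λ u → 2 * χ T u + 2 * χ B u)   ≤⟨ sum-mono charge ⟩
    sum row                             ≡⟨ weight≡∑row ⟨
    weight (G ∘ₗ H) f                   ∎
    where
    open ≤-Reasoning

    Undominated : Pred (Fin m) 0ℓ
    Undominated u = ∀ x → Adj G u x → ¬ HasTwo x

    undominated? : Decidable Undominated
    undominated? u = all? λ x → adj? G u x →-dec ¬? (hasTwo? x)

    T B I : Subset m
    I? : Decidable λ x → ∃ λ u → Undominated u × proj₁ (noIso u) ≡ x
    I? x = any? λ u → undominated? u ×-dec (proj₁ (noIso u) ≟ x)
    T = ⟦ hasTwo? ⟧
    B = ⟦ undominated? ⟧
    I = ⟦ I? ⟧

    ∣I∣≤∣B∣ : ∣ I ∣ ≤ ∣ B ∣
    ∣I∣≤∣B∣ = ∣∣-injection (λ x u → proj₁ (noIso u) ≡ x) I B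
      (λ x∈I → let u , undom , e = ∈⟦⟧⁻ I? x∈I in u , ∈⟦⟧⁺ undominated? undom , e)
      (λ e e′ → trans (sym e) e′)

    total : TotalDominating G (T ∪ I)
    total u with any? (λ x → adj? G u x ×-dec hasTwo? x)
    ... | yes (x , a , two) = x , x∈p∪q⁺ (inj₁ (∈⟦⟧⁺ hasTwo? two)) , a
    ... | no ∄ = proj₁ (noIso u) ,
      x∈p∪q⁺ (inj₂ (∈⟦⟧⁺ I? (u , (λ x a two → ∄ (x , a , two)) , refl))) , proj₂ (noIso u)

    -- Without a 2 in the adjacent fibres, every 0 over `u` is defended inside its own fibre.
    row-prdf : ∀ {u} → Undominated u → ∀ v → F u v ≡ 0F → ∃ λ w → F u w ≡ 2F × Adj H v w
    row-prdf undom v Fuv≡0 with defended Fuv≡0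
    ... | (x , y) , (Fxy≡2 , inj₁ a) , _             = ⊥-elim (undom x a (y , Fxy≡2))
    ... | (_ , y) , (Fuy≡2 , inj₂ (refl , vy)) , _   = y , Fuy≡2 , vy

    -- A fibre is charged 4 only if it contains a 2 and is undominated, where `prdf-row-weight`
    -- applies. An undominated fibre without a 2 has no 0 either, so it weighs at least n ≥ 2.
    charge : ∀ u → 2 * χ T u + 2 * χ B u ≤ row u
    charge u with hasTwo? u | undominated? u
    ... | yes (_ , Fuv≡2) | yes undom = ≤-trans
      (+-mono-≤ (*-monoʳ-≤ 2 (χ≤1 T u)) (*-monoʳ-≤ 2 (χ≤1 B u)))
      (prdf-row-weight H Δ+3≤n (F u) (row-prdf undom) Fuv≡2)
    ... | yes (_ , Fuv≡2) | no dom rewrite χ-∉ B {u} (dom ∘ ∈⟦⟧⁻ undominated?) =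
      ≤-trans (+-monoˡ-≤ 0 (*-monoʳ-≤ 2 (χ≤1 T u))) (two⇒2≤sum (F u) Fuv≡2)
    ... | no ¬two | yes undom rewrite χ-∉ T {u} (¬two ∘ ∈⟦⟧⁻ hasTwo?) =
      ≤-trans (*-monoʳ-≤ 2 (χ≤1 B u))
        (noZero⇒2≤row λ v Fuv≡0 → let w , Fuw≡2 , _ = row-prdf undom v Fuv≡0 in ¬two (w , Fuw≡2))
    ... | no ¬two | no dom
      rewrite χ-∉ T {u} (¬two ∘ ∈⟦⟧⁻ hasTwo?) | χ-∉ B {u} (dom ∘ ∈⟦⟧⁻ undominated?) = z≤n

-- An upper bound for γᵖᴿ from dominating open packings

-- For S an open packing and a dominating set of G, put 2 on (x , v₀) for x ∈ S₁, and
-- 2 on (x , v₁) and 1 on (x , v₀) for x ∈ S₀.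
module _ (G : Graph m) (H : Graph n) {v₀ v₁ : Fin n} (iso : Isolated H v₀) (v₀≢v₁ : v₀ ≢ v₁)
         (near : ∀ v → v ≢ v₀ → v ≢ v₁ → Adj H v₁ v)
         {S : Subset m} (packing : OpenPacking G S) (dom : Dominating G S) where

  private
    S₀ S₁ : Subset m
    S₀ = isolatedPart G S
    S₁ = nonIsolatedPart G S

    ∈S₀⁻ : ∀ {u} → u ∈ S₀ → u ∈ S × (∀ x → x ∈ S → ¬ Adj G u x)
    ∈S₀⁻ = ∈⟦⟧⁻ (isolatedIn? G S)

    Two One : Pred (Fin m × Fin n) 0ℓ
    Two (x , y) = x ∈ S × (x ∈ S₀ × y ≡ v₁ ⊎ x ∉ S₀ × y ≡ v₀)
    One (x , y) = x ∈ S₀ × y ≡ v₀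

    two? : Decidable Two
    two? (x , y) = (x ∈? S) ×-dec
      (((x ∈? S₀) ×-dec (y ≟ v₁)) ⊎-dec (¬? (x ∈? S₀) ×-dec (y ≟ v₀)))

    one? : Decidable One
    one? (x , y) = (x ∈? S₀) ×-dec (y ≟ v₀)

    F : Fin m × Fin n → Fin 3
    F p = label (two? p) (one? p)

    f : Vec (Fin 3) (m * n)
    f = tabulate (F ∘ remQuot n)

    two-unique : ∀ {x y y′} → Two (x , y) → Two (x , y′) → y ≡ y′
    two-unique (_ , inj₁ (_ , e))  (_ , inj₁ (_ , e′)) = trans e (sym e′)
    two-unique (_ , inj₁ (x∈ , _)) (_ , inj₂ (x∉ , _)) = ⊥-elim (x∉ x∈)
    two-unique (_ , inj₂ (x∉ , _)) (_ , inj₁ (x∈ , _)) = ⊥-elim (x∉ x∈)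
    two-unique (_ , inj₂ (_ , e))  (_ , inj₂ (_ , e′)) = trans e (sym e′)

    two-exists : ∀ {x} → x ∈ S → ∃ λ y → Two (x , y)
    two-exists {x} x∈S with x ∈? S₀
    ... | yes x∈S₀ = v₁ , x∈S , inj₁ (x∈S₀ , refl)
    ... | no  x∉S₀ = v₀ , x∈S , inj₂ (x∉S₀ , refl)

    -- The packing makes `x` the only neighbour of `u` in `S`, and each fibre over `S` holds a
    -- single 2; `away` rules out a second defender in the fibre of `u` itself.
    defended-outside : ∀ {u v x} → x ∈ S → Adj G u x → (∀ {y} → Two (u , y) → ¬ Adj H v y) →
      ∃! _≡_ λ xy → Two xy × LexAdj G H (u , v) xy
    defended-outside {u} {v} {x} x∈S ux away with two-exists x∈S
    ... | y , two = (x , y) , (two , inj₁ ux) , unique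
      where
      unique : ∀ {xy} → Two xy × LexAdj G H (u , v) xy → (x , y) ≡ xy
      unique (two′ , inj₁ ux′) with refl ← openPacking-unique G packing x∈S (proj₁ two′) ux ux′ =
        cong (x ,_) (two-unique two two′)
      unique (two′ , inj₂ (refl , vy)) = ⊥-elim (away two′ vy)

    -- Over S₀ the defender is (u, v₁), since `v₁` misses only `v₀` and no neighbour of `u` lies in
    -- `S`. Any other `u` has a neighbour in `S`, and a 2 over `u` itself sits at the isolated `v₀`,
    -- where it defends nothing in that fibre.
    defended : ∀ u v → ¬ Two (u , v) → ¬ One (u , v) → ∃! _≡_ λ xy → Two xy × LexAdj G H (u , v) xy
    defended u v ¬two ¬one with u ∈? S₀ | any? (λ x → (x ∈? S) ×-dec adj? G u x)
    ... | no u∉S₀ | yes (x , x∈S , ux) = defended-outside x∈S ux λ where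
      (_ , inj₁ (u∈S₀ , _)) _  → u∉S₀ u∈S₀
      (_ , inj₂ (_ , refl)) vy → iso v (symm H vy)
    ... | no u∉S₀ | no ∄ with u ∈? S
    ...   | yes u∈S = ⊥-elim (u∉S₀ (∈⟦⟧⁺ (isolatedIn? G S) (u∈S , λ x x∈S ux → ∄ (x , x∈S , ux))))
    ...   | no  u∉S = ⊥-elim (∄ (dom u u∉S))
    defended u v ¬two ¬one | yes u∈S₀ | _ = (u , v₁) , (two , inj₂ (refl , symm H v₁v)) , unique
      where
      u∈S : u ∈ S
      u∈S = proj₁ (∈S₀⁻ u∈S₀)

      two : Two (u , v₁)
      two = u∈S , inj₁ (u∈S₀ , refl)

      v₁v : Adj H v₁ v
      v₁v = near v (λ e → ¬one (u∈S₀ , e)) (λ e → ¬two (u∈S , inj₁ (u∈S₀ , e)))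

      unique : ∀ {xy} → Two xy × LexAdj G H (u , v) xy → (u , v₁) ≡ xy
      unique (two′ , inj₁ ux)         = ⊥-elim (proj₂ (∈S₀⁻ u∈S₀) _ (proj₁ two′) ux)
      unique (two′ , inj₂ (refl , _)) = cong (u ,_) (two-unique two two′)

    prdf : PRDF (G ∘ₗ H) f
    prdf p fp≡0 = ∃!-fibre⁺ G H {Two}
      (λ {q} fq≡2 → label≡2 (two? _) (one? _) (trans (sym (lookup∘tabulate _ q)) fq≡2))
      (λ {q} two → trans (lookup∘tabulate _ q) (2≡label (two? _) (one? _) two))
      p (uncurry (defended _ _) (label≡0 (two? _) (one? _) (trans (sym (lookup∘tabulate _ p)) fp≡0)))

    row : Fin m → ℕ
    row u = sum λ v → toℕ (F (u , v))

    -- Here `a` and `b` are budgets for the values at `v₀` and `v₁`; the rest of the row has budget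
    -- 0.
    row≤ : ∀ a b {u} → (∀ {v} → Two (u , v) → 2 ≤ a * χ ⁅ v₀ ⁆ v + b * χ ⁅ v₁ ⁆ v) →
      (∀ {v} → One (u , v) → 1 ≤ a * χ ⁅ v₀ ⁆ v + b * χ ⁅ v₁ ⁆ v) → row u ≤ a + b
    row≤ a b {u} two⇒ one⇒ = begin
      row u
        ≤⟨ sum-mono (λ v → label≤ (two? (u , v)) (one? (u , v)) two⇒ one⇒) ⟩
      sum (λ v → a * χ ⁅ v₀ ⁆ v + b * χ ⁅ v₁ ⁆ v)
        ≡⟨ sum-χ₂ a b ⁅ v₀ ⁆ ⁅ v₁ ⁆ ⟩
      a * ∣ ⁅ v₀ ⁆ ∣ + b * ∣ ⁅ v₁ ⁆ ∣
        ≡⟨ cong₂ (λ i j → a * i + b * j) (∣⁅x⁆∣≡1 v₀) (∣⁅x⁆∣≡1 v₁) ⟩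
      a * 1 + b * 1
        ≡⟨ cong₂ _+_ (*-identityʳ a) (*-identityʳ b) ⟩
      a + b ∎
      where open ≤-Reasoning

    charge : ∀ u → row u ≤ 2 * χ S₁ u + 3 * χ S₀ u
    charge u = go (u ∈? S₀) (u ∈? S)
      where
      at : ∀ v k → k ≤ k * χ ⁅ v ⁆ v
      at v k = ≤-reflexive (sym (trans (cong (k *_) (χ-∈ (x∈⁅x⁆ v))) (*-identityʳ k)))

      go : Dec (u ∈ S₀) → Dec (u ∈ S) → row u ≤ 2 * χ S₁ u + 3 * χ S₀ u
      go (yes u∈S₀) _ rewrite χ-∈ u∈S₀ = ≤-trans
        (row≤ 1 2 (λ where
            (_ , inj₁ (_ , refl)) → ≤-trans (at v₁ 2) (m≤n+m _ (1 * χ ⁅ v₀ ⁆ v₁))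
            (_ , inj₂ (u∉S₀ , _)) → ⊥-elim (u∉S₀ u∈S₀))
          (λ where (_ , refl) → ≤-trans (at v₀ 1) (m≤m+n _ _)))
        (m≤n+m 3 (2 * χ S₁ u))
      go (no u∉S₀) (yes u∈S) rewrite χ-∈ (x∈p∧x∉q⇒x∈p─q u∈S u∉S₀) = ≤-trans
        (row≤ 2 0 (λ where
            (_ , inj₁ (u∈S₀ , _)) → ⊥-elim (u∉S₀ u∈S₀)
            (_ , inj₂ (_ , refl)) → ≤-trans (at v₀ 2) (m≤m+n _ _))
          (λ (u∈S₀ , _) → ⊥-elim (u∉S₀ u∈S₀)))
        (m≤m+n 2 _)
      go (no u∉S₀) (no u∉S) = ≤-trans
        (row≤ 0 0 (λ (u∈S , _) → ⊥-elim (u∉S u∈S)) (λ (u∈S₀ , _) → ⊥-elim (u∉S₀ u∈S₀))) z≤n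

    row-f : ∀ u → sum (λ (v : Fin n) → toℕ (lookup f (combine u v))) ≡ row u
    row-f u = sum-cong-≗ λ v → cong toℕ
      (trans (lookup∘tabulate (F ∘ remQuot n) (combine u v)) (cong F (remQuot-combine u v)))

  γᵖᴿ≤2∣S₁∣+3∣S₀∣ : γᵖᴿ (G ∘ₗ H) ≤ 2 * ∣ S₁ ∣ + 3 * ∣ S₀ ∣
  γᵖᴿ≤2∣S₁∣+3∣S₀∣ = begin
    γᵖᴿ (G ∘ₗ H)                          ≤⟨ proj₂ (γᵖᴿ-minimum (G ∘ₗ H)) f prdf ⟩
    weight (G ∘ₗ H) f                     ≡⟨ ∑-weight (G ∘ₗ H) f ⟩
    sum (toℕ ∘ lookup f)                  ≡⟨ sum-combine {m} {n} (toℕ ∘ lookup f) ⟩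
    sum (λ (u : Fin m) → sum λ (v : Fin n) → toℕ (lookup f (combine u v)))
                                          ≡⟨ sum-cong-≗ row-f ⟩
    sum row                               ≤⟨ sum-mono charge ⟩
    sum (λ u → 2 * χ S₁ u + 3 * χ S₀ u)   ≡⟨ sum-χ₂ 2 3 S₁ S₀ ⟩
    2 * ∣ S₁ ∣ + 3 * ∣ S₀ ∣               ∎
    where open ≤-Reasoning

-- The three ranges of Δ H

theorem4p12 : {m n : ℕ} (G : Graph m) (H : Graph n)
    (conn : Connected G) (nontriv : Nontrivial G) → Nontrivial H →
    let γₜG = γₜ G (connected⇒noIsolated G conn nontriv) in
    (Δ H + 1 ≡ n → (γᵖᴿ (G ∘ₗ H) ≡ 2 * γᵖ (G ∘ₗ H) ⇔ P₂ G H))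
    × (Δ H + 2 ≡ n →
    (γᵖᴿ (G ∘ₗ H) ≡ 2 * γᵖ (G ∘ₗ H) →
    P₁ G H
    × ((S : Subset m) → OpenPacking G S → Dominating G S →
    2 * γₜG ≤ 2 * ∣ nonIsolatedPart G S ∣ + 3 * ∣ isolatedPart G S ∣))
    × (γᵖᴿ G ≡ 2 * γₜG ⊎ γₜG ≡ γ G →
    (γᵖᴿ (G ∘ₗ H) ≡ 2 * γᵖ (G ∘ₗ H) ⇔ P₁ G H)))
    × (Δ H + 3 ≤ n → (γᵖᴿ (G ∘ₗ H) ≡ 2 * γᵖ (G ∘ₗ H) ⇔ P₁ G H))
theorem4p12 {m} {n} G H conn nontriv 2≤n = part-i , part-ii , part-iii
  where
  noIso : NoIsolated G
  noIso = connected⇒noIsolated G conn nontriv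

  u₀ : Fin m
  u₀ = proj₁ (two-elements nontriv)

  v₀ : Fin n
  v₀ = proj₁ (two-elements 2≤n)

  Equality : Set
  Equality = γᵖᴿ (G ∘ₗ H) ≡ 2 * γᵖ (G ∘ₗ H)

  -- The inequality `γᵖᴿ≤2γᵖ` holds for every graph, so only the lower bound depends on `G` and `H`.
  equality : (∀ f → PRDF (G ∘ₗ H) f → 2 * γᵖ (G ∘ₗ H) ≤ weight (G ∘ₗ H) f) → Equality
  equality bound =
    let (f , prdf , weight≡) , _ = γᵖᴿ-minimum (G ∘ₗ H)
    in ≤-antisym (γᵖᴿ≤2γᵖ (G ∘ₗ H)) (subst (2 * γᵖ (G ∘ₗ H) ≤_) weight≡ (bound f prdf))

  noUniversal : Δ H + 2 ≤ n → ∀ v → ¬ Universal H v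
  noUniversal Δ+2≤n v univ = <-irrefl refl (begin
    suc n              ≤⟨ s≤s (universal⇒n≤degree+1 H univ) ⟩
    suc (degree H v + 1) ≡⟨ +-suc (degree H v) 1 ⟨
    degree H v + 2     ≤⟨ +-monoˡ-≤ 2 (degree≤Δ H v) ⟩
    Δ H + 2            ≤⟨ Δ+2≤n ⟩
    n                  ∎)
    where open ≤-Reasoning

  equality⇒P₁ : Δ H + 2 ≤ n → Equality → P₁ G H × γₜ G noIso ≤ γᵖ (G ∘ₗ H)
  equality⇒P₁ Δ+2≤n eq =
    let (S , pd , ∣S∣≡γᵖ) , _ = γᵖ-minimum (G ∘ₗ H)
        gap = equality⇒gap G H conn 2≤n eq pd ∣S∣≡γᵖ
    in projection⇒P₁ G H pd noIso gap (noUniversal Δ+2≤n) u₀ ,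
       subst (γₜ G noIso ≤_) ∣S∣≡γᵖ (γₜ≤∣S∣ G H pd noIso gap (noUniversal Δ+2≤n))

  P₁⇒equality : (∀ f → PRDF (G ∘ₗ H) f → 2 * γₜ G noIso ≤ weight (G ∘ₗ H) f) → P₁ G H → Equality
  P₁⇒equality bound p₁ = equality λ f prdf →
    ≤-trans (*-monoʳ-≤ 2 (P₁⇒γᵖ≤γₜ G H noIso v₀ p₁)) (bound f prdf)

  part-i : Δ H + 1 ≡ n → Equality ⇔ P₂ G H
  part-i Δ+1≡n = mk⇔ forward λ (_ , efficient) → equality λ f prdf →
    ≤-trans (*-monoʳ-≤ 2 (efficientClosed⇒γᵖ≤γ G H univ efficient)) (2γ≤weight G H 2≤n f prdf)
    where
    univ : Universal H (proj₁ (Δ-attained H v₀))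
    univ = degree≡n∸1⇒universal H _ (trans (cong (_+ 1) (proj₂ (Δ-attained H v₀))) Δ+1≡n)

    forward : Equality → P₂ G H
    forward eq =
      let (S , pd , ∣S∣≡γᵖ) , _ = γᵖ-minimum (G ∘ₗ H)
      in universal⇒γ≡1 H univ ,
         projection⇒efficientClosed G H pd noIso (equality⇒gap G H conn 2≤n eq pd ∣S∣≡γᵖ) univ

  -- If the isolated `w` itself attains the maximum, all degrees are 0 and any other vertex serves.
  max-degree-vertex≢ : ∀ w → Isolated H w → ∃ λ v → w ≢ v × degree H v ≡ Δ H
  max-degree-vertex≢ w iso with Δ-attained H w
  ... | v , deg with w ≟ v
  ...   | no  w≢v  = v , w≢v , deg
  ...   | yes refl with other-element 2≤n w
  ...     | x , w≢x = x , w≢x , ≤-antisym (degree≤Δ H x)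
    (≤-trans (≤-reflexive (trans (sym deg) (isolated⇒degree≡0 H iso))) z≤n)

  part-iia : Δ H + 2 ≡ n → Equality → P₁ G H
    × ((S : Subset m) → OpenPacking G S → Dominating G S →
        2 * γₜ G noIso ≤ 2 * ∣ nonIsolatedPart G S ∣ + 3 * ∣ isolatedPart G S ∣)
  part-iia Δ+2≡n eq = p₁ , bound
    where
    p₁ : P₁ G H
    p₁ = proj₁ (equality⇒P₁ (≤-reflexive Δ+2≡n) eq)

    bound : (S : Subset m) → OpenPacking G S → Dominating G S →
      2 * γₜ G noIso ≤ 2 * ∣ nonIsolatedPart G S ∣ + 3 * ∣ isolatedPart G S ∣
    bound S packing dom =
      -- The construction on dominating open packings is applied with `w` as its isolated vertex and
      -- with `v`, of degree n - 2, as the vertex that misses only itself and `w`.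
      let w , iso = δ≡0⇒isolated H v₀ (proj₁ p₁)
          v , w≢v , deg = max-degree-vertex≢ w iso
          near = degree≡n∸2⇒adj H iso w≢v (trans (cong (_+ 2) deg) Δ+2≡n)
      in begin
      2 * γₜ G noIso         ≤⟨ *-monoʳ-≤ 2 (proj₂ (equality⇒P₁ (≤-reflexive Δ+2≡n) eq)) ⟩
      2 * γᵖ (G ∘ₗ H)        ≡⟨ eq ⟨
      γᵖᴿ (G ∘ₗ H)           ≤⟨ γᵖᴿ≤2∣S₁∣+3∣S₀∣ G H iso w≢v near packing dom ⟩
      2 * ∣ nonIsolatedPart G S ∣ + 3 * ∣ isolatedPart G S ∣ ∎
      where open ≤-Reasoning

  part-ii : Δ H + 2 ≡ n →
    (Equality → P₁ G H
      × ((S : Subset m) → OpenPacking G S → Dominating G S →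
          2 * γₜ G noIso ≤ 2 * ∣ nonIsolatedPart G S ∣ + 3 * ∣ isolatedPart G S ∣))
    × (γᵖᴿ G ≡ 2 * γₜ G noIso ⊎ γₜ G noIso ≡ γ G → Equality ⇔ P₁ G H)
  part-ii Δ+2≡n = part-iia Δ+2≡n , λ where
    (inj₁ γᵖᴿ≡2γₜ) → mk⇔ (proj₁ ∘ part-iia Δ+2≡n) (P₁⇒equality λ f prdf →
      subst (_≤ weight (G ∘ₗ H) f) γᵖᴿ≡2γₜ (γᵖᴿ≤weight G H 2≤n f prdf))
    (inj₂ γₜ≡γ) → mk⇔ (proj₁ ∘ part-iia Δ+2≡n) (P₁⇒equality λ f prdf →
      subst (λ k → 2 * k ≤ weight (G ∘ₗ H) f) (sym γₜ≡γ) (2γ≤weight G H 2≤n f prdf))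

  part-iii : Δ H + 3 ≤ n → Equality ⇔ P₁ G H
  part-iii Δ+3≤n = mk⇔
    (proj₁ ∘ equality⇒P₁ (≤-trans (+-monoʳ-≤ (Δ H) (n≤1+n 2)) Δ+3≤n))
    (P₁⇒equality λ f prdf → 2γₜ≤weight G H 2≤n f prdf noIso Δ+3≤n)
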